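{- Let $n\geq 13$ be an integer. Then the achromatic arboricity of the complete graph $K_n$ satisfies \[\frac{1}{4}n^{\frac{3}{2}}-\Theta(n) \leq A_{\alpha}(K_{n})\leq \frac{1}{\sqrt{2}}n^{\frac{3}{2}}-\Theta(n).\]
   Context: All graphs are finite and simple. For a graph $G$, the achromatic arboricity $A_{\alpha}(G)$ is the largest integer $k$ for which there is a surjective coloring $\varsigma\colon E(G)\to\{1,\dots,k\}$ of the edges of $G$ such that every color class $\varsigma^{ -1}(i)$ induces an acyclic subgraph (a forest), and for any two distinct colors $i\neq j$ the subgraph formed by the edges of $\varsigma^{ -1}(i)\cup\varsigma^{ -1}(j)$ contains at least one cycle. -}

module Defs where

open import Data.Nat using (ℕ; _≤_; _+_; _*_; _^_)
open import Data.Fin using (Fin)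
open import Data.List using (List; _∷_; []; _++_; length)
open import Data.List.Relation.Unary.Linked using (Linked)
open import Data.List.Relation.Unary.Unique.Propositional using (Unique)
open import Data.Product using (Σ; ∃; _×_)
open import Data.Sum using (_⊎_)
open import Relation.Nullary using (¬_)
open import Relation.Binary.PropositionalEquality using (_≡_; _≢_)

-- The complete graph K_n has vertex set Fin n and an edge between any two
-- distinct vertices.  A spanning subgraph of K_n is given by a relation S
-- on vertices (an edge u v is present iff S u v holds).

-- A cycle in S: distinct vertices x, y₁, …, y_m (m ≥ 2, so at least 3
-- vertices), consecutive ones adjacent, and the last adjacent to x.
HasCycle : {n : ℕ} → (Fin n → Fin n → Set) → Set
HasCycle {n} S =
  Σ (Fin n) λ x → Σ (List (Fin n)) λ ys →
    (2 ≤ length ys) × Unique (x ∷ ys) × Linked S ((x ∷ ys) ++ (x ∷ []))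

-- An edge colouring of K_n with colours Fin k (colour of edge {u,v} is
-- col u v = col v u; the diagonal values are irrelevant).
EdgeColoring : ℕ → ℕ → Set
EdgeColoring n k = Fin n → Fin n → Fin k

ColorClass₂ : {n k : ℕ} → EdgeColoring n k → Fin k → Fin k → Fin n → Fin n → Set
ColorClass₂ col a b u v = (u ≢ v) × (col u v ≡ a ⊎ col u v ≡ b)

ColorClass : {n k : ℕ} → EdgeColoring n k → Fin k → Fin n → Fin n → Set
ColorClass col a u v = (u ≢ v) × (col u v ≡ a)

IsAchromaticArbColoring : (n k : ℕ) → EdgeColoring n k → Set
IsAchromaticArbColoring n k col =
  (∀ u v → col u v ≡ col v u)
  × (∀ (a : Fin k) → Σ (Fin n) λ u → Σ (Fin n) λ v → (u ≢ v) × (col u v ≡ a))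
  × (∀ (a : Fin k) → ¬ HasCycle (ColorClass col a))
  × (∀ (a b : Fin k) → a ≢ b → HasCycle (ColorClass₂ col a b))

HasAchromaticArbColoring : ℕ → ℕ → Set
HasAchromaticArbColoring n k = Σ (EdgeColoring n k) (IsAchromaticArbColoring n k)

IsAchromaticArboricityK : ℕ → ℕ → Set
IsAchromaticArboricityK n A =
  HasAchromaticArbColoring n A × (∀ k → HasAchromaticArbColoring n k → k ≤ A)

{-# OPTIONS --safe #-}
module Submission where

-- Upper bound.  Let i be a colour with fewest edges, D the sum of its degrees, V the set of vertices
-- it covers, and V′ ⊆ V the set of those having an i-neighbour of i-degree at least 2.  Walking along a
-- cycle in the union of the colours i and j shows that j has two edges meeting V, or one edge inside V′.
-- Double counting over all j gives 4(k - 1) + |V|² ≤ 2n|V| + |V′|², while |V′| + 2|V| ≤ 2D and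
-- kD ≤ n(n - 1); eliminating V, V′ and D leaves 8k(k - 1) + (k - 1)(n - 1) ≤ 4n²(n - 1).
--
-- Lower bound.  Take a v × (v + 1) grid of vertices and one further vertex w p for every pair p = (i , a)
-- of rows with i < a.  The colour (p , j) consists of the star from the grid vertex (i , j) to row a and
-- of the star from w p to column j + 1.  Rows meet columns, so any two such double stars close a
-- cycle.  This uses about 3v²/2 vertices for about v³/2 colours, and (2/3)^{3/2}/2 > 1/4.  The remaining
-- edges get private colours, after which colours with acyclic union are merged as long as possible.

open import Defs
open import Data.Nat using (ℕ; zero; suc; _+_; _*_; _∸_; _^_; _⊔_; _≤_; _<_; _≤?_; _<?_; z≤n; s≤s; NonZero; _/_; _%_)
open import Data.Nat.Properties
open import Data.Nat.DivMod using (m≡m%n+[m/n]*n; [m+kn]%n≡m%n; [m+n]%n≡m%n; m%n<n; m<n⇒m%n≡m; n%n≡0)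
open import Data.Nat.Tactic.RingSolver using (solve-∀)
open import Algebra.Properties.Semiring.Sum +-*-semiring using (sum; sum-remove; sum-cong-≗; ∑-distrib-+; ∑-comm; *-distribˡ-sum; *-distribʳ-sum)
open import Data.Fin as Fin using (Fin; zero; suc; toℕ; fromℕ; combine; remQuot; punchIn; punchOut; inject₁; inject≤; finToFun; funToFin; _↑ˡ_; _↑ʳ_)
open import Data.Fin.Properties as Finₚ using (any?; all?; injective⇒≤; inject₁-injective; combine-injective; punchOut-injective; finToFun-funToFin)
open import Data.List using (List; []; _∷_; _++_; length; applyUpTo)
open import Data.List.Properties using (applyUpTo-∷ʳ; length-applyUpTo)
open import Data.List.Relation.Unary.All using (All; []; _∷_)
open import Data.List.Relation.Unary.AllPairs using ([]; _∷_)
open import Data.List.Relation.Unary.Linked as Linked using (Linked; [-]; _∷_; linked?)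
import Data.List.Relation.Unary.Linked.Properties as Linkedₚ
open import Data.List.Relation.Unary.Unique.Propositional using (Unique)
import Data.List.Relation.Unary.Unique.DecPropositional as DecUnique
import Data.List.Relation.Unary.Unique.Propositional.Properties as Uniqueₚ
open import Data.Product using (Σ; ∃; _×_; _,_; proj₁; proj₂)
open import Data.Product.Properties using (≡-dec)
open import Data.Sum using (_⊎_; inj₁; inj₂; [_,_]′; swap)
open import Data.Empty using (⊥; ⊥-elim)
open import Function using (_∘_)
open import Relation.Nullary using (¬_; Dec; yes; no)
open import Relation.Nullary.Decidable using (map′; _×-dec_; _⊎-dec_; _→-dec_; ¬?; decidable-stable)
open import Relation.Binary.Definitions using (Tri; tri<; tri≈; tri>)
open import Relation.Unary using (Decidable)
open import Relation.Binary.PropositionalEquality using (_≡_; _≢_; refl; sym; trans; cong; cong₂; subst; subst₂; module ≡-Reasoning)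

-- Cycles as periodic walks

hasCycle-map : ∀ {n} {R S : Fin n → Fin n → Set} → (∀ {u v} → R u v → S u v) → HasCycle R → HasCycle S
hasCycle-map f (x , ys , 2≤ , uniq , linked) = x , ys , 2≤ , uniq , Linked.map f linked

at : {A : Set} → A → List A → ℕ → A
at d []       _       = d
at d (x ∷ xs) zero    = x
at d (x ∷ xs) (suc t) = at d xs t

at-length : {A : Set} (d : A) (xs : List A) → at d xs (length xs) ≡ d
at-length d []       = refl
at-length d (x ∷ xs) = at-length d xs

all-at : {A : Set} {P : A → Set} {d : A} {xs : List A} → All P xs → ∀ {t} → t < length xs → P (at d xs t)
all-at (p ∷ ps) {zero}  _         = p
all-at (p ∷ ps) {suc t} (s≤s t<l) = all-at ps t<l

at-distinct : {A : Set} {d : A} {xs : List A} → Unique xs → ∀ {s t} → s < t → t < length xs → at d xs s ≢ at d xs t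
at-distinct (p ∷ _) {zero}  {suc t} _         (s≤s t<l) = all-at p t<l
at-distinct (_ ∷ u) {suc s} {suc t} (s≤s s<t) (s≤s t<l) = at-distinct u s<t t<l

linked⇒at : {A : Set} {S : A → A → Set} {d : A} (xs : List A) → Linked S (xs ++ (d ∷ [])) →
            ∀ {t} → t < length xs → S (at d xs t) (at d xs (suc t))
linked⇒at (x ∷ [])     (r ∷ _) {zero}  _         = r
linked⇒at (x ∷ y ∷ ys) (r ∷ _) {zero}  _         = r
linked⇒at (x ∷ ys)     l       {suc t} (s≤s t<l) = linked⇒at ys (Linked.tail l) t<l

-- Indices run over all of ℕ with period `m`, so rotating the cycle only adds to the index and later
-- case distinctions need no modular arithmetic. For the same reason `distinct` speaks of every
-- window of `m` consecutive indices.
record PeriodicCycle {n : ℕ} (S : Fin n → Fin n → Set) : Set where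
  field
    m        : ℕ
    3≤m      : 3 ≤ m
    vertex   : ℕ → Fin n
    periodic : ∀ t → vertex (m + t) ≡ vertex t
    distinct : ∀ {s t} → s < t → t < m + s → vertex s ≢ vertex t
    step     : ∀ t → S (vertex t) (vertex (suc t))

suc-% : ∀ t m .{{_ : NonZero m}} → (suc (t % m) < m × suc t % m ≡ suc (t % m)) ⊎ (suc (t % m) ≡ m × suc t % m ≡ 0)
suc-% t m with m≤n⇒m<n∨m≡n (m%n<n t m)
  | trans (cong (λ z → suc z % m) (m≡m%n+[m/n]*n t m)) ([m+kn]%n≡m%n (suc (t % m)) (t / m) m)
... | inj₁ lt | eq = inj₁ (lt , trans eq (m<n⇒m%n≡m lt))
... | inj₂ e  | eq = inj₂ (e , trans eq (trans (cong (_% m) e) (n%n≡0 m)))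

%-distinct : ∀ {s t} m .{{_ : NonZero m}} → s < t → t < m + s → s % m ≢ t % m
%-distinct {s} {t} m s<t t<m+s e = contra (<-cmp (s / m) (t / m))
  where
  r = s % m
  s≡ : s ≡ r + (s / m) * m
  s≡ = m≡m%n+[m/n]*n s m
  t≡ : t ≡ r + (t / m) * m
  t≡ = trans (m≡m%n+[m/n]*n t m) (cong (_+ (t / m) * m) (sym e))
  contra : Tri (s / m < t / m) (s / m ≡ t / m) (t / m < s / m) → ⊥
  contra (tri≈ _ q _) = <-irrefl (trans s≡ (trans (cong (λ z → r + z * m) q) (sym t≡))) s<t
  contra (tri> _ _ q) = <-irrefl refl (<-≤-trans s<t
    (subst₂ _≤_ (sym t≡) (sym s≡) (+-monoʳ-≤ r (*-monoˡ-≤ m (<⇒≤ q)))))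
  contra (tri< q _ _) = <-irrefl refl (<-≤-trans t<m+s (begin
    m + s                 ≡⟨ cong (m +_) s≡ ⟩
    m + (r + (s / m) * m) ≡⟨ sym (+-assoc m r _) ⟩
    m + r + (s / m) * m   ≡⟨ cong (_+ (s / m) * m) (+-comm m r) ⟩
    r + m + (s / m) * m   ≡⟨ +-assoc r m _ ⟩
    r + suc (s / m) * m   ≤⟨ +-monoʳ-≤ r (*-monoˡ-≤ m q) ⟩
    r + (t / m) * m       ≡⟨ sym t≡ ⟩
    t                     ∎))
    where open ≤-Reasoning

periodicCycle : ∀ {n} {S : Fin n → Fin n → Set} → HasCycle S → PeriodicCycle S
periodicCycle {n} {S} (x , ys , 2≤ , uniq , linked) = record
  { m        = m
  ; 3≤m      = s≤s 2≤
  ; vertex   = λ t → at x xs (t % m)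
  ; periodic = λ t → cong (at x xs) (trans (cong (_% m) (+-comm m t)) ([m+n]%n≡m%n t m))
  ; distinct = dist
  ; step     = step′
  }
  where
  xs = x ∷ ys
  m  = length xs
  dist : ∀ {s t} → s < t → t < m + s → at x xs (s % m) ≢ at x xs (t % m)
  dist {s} {t} s<t t< with <-cmp (s % m) (t % m)
  ... | tri< q _ _ = at-distinct uniq q (m%n<n t m)
  ... | tri≈ _ q _ = ⊥-elim (%-distinct m s<t t< q)
  ... | tri> _ _ q = at-distinct uniq q (m%n<n s m) ∘ sym
  step′ : ∀ t → S (at x xs (t % m)) (at x xs (suc t % m))
  step′ t with suc-% t m | linked⇒at xs linked (m%n<n t m)
  ... | inj₁ (_ , e) | r = subst (λ z → S (at x xs (t % m)) (at x xs z)) (sym e) r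
  ... | inj₂ (l , e) | r = subst (S (at x xs (t % m)))
          (trans (trans (cong (at x xs) l) (at-length x xs)) (cong (at x xs) (sym e))) r

shift : ∀ {n} {S : Fin n → Fin n → Set} → ℕ → PeriodicCycle S → PeriodicCycle S
shift {S = S} k C = record
  { m        = m
  ; 3≤m      = 3≤m
  ; vertex   = λ t → vertex (k + t)
  ; periodic = λ t → trans (cong vertex (exchange k m t)) (periodic (k + t))
  ; distinct = λ {s} {t} s<t t< → distinct (+-monoʳ-< k s<t) (subst (k + t <_) (exchange k m s) (+-monoʳ-< k t<))
  ; step     = λ t → subst (λ z → S (vertex (k + t)) (vertex z)) (sym (+-suc k t)) (step (k + t))
  }
  where
  open PeriodicCycle C
  exchange : ∀ a b c → a + (b + c) ≡ b + (a + c)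
  exchange a b c = trans (sym (+-assoc a b c)) (trans (cong (_+ c) (+-comm a b)) (+-assoc b a c))

argmax : (f : ℕ → ℕ) (m : ℕ) → Σ ℕ λ t → t ≤ m × (∀ {s} → s ≤ m → f s ≤ f t)
argmax f zero    = 0 , z≤n , λ { z≤n → ≤-refl }
argmax f (suc m) with argmax f m
... | t , t≤m , max with ≤-total (f t) (f (suc m))
... | inj₁ le = suc m , ≤-refl , λ s≤ → bound (m≤n⇒m<n∨m≡n s≤)
  where bound : ∀ {s} → s < suc m ⊎ s ≡ suc m → f s ≤ f (suc m)
        bound (inj₁ (s≤s q)) = ≤-trans (max q) le
        bound (inj₂ refl)    = ≤-refl
... | inj₂ ge = t , m≤n⇒m≤1+n t≤m , λ s≤ → bound (m≤n⇒m<n∨m≡n s≤)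
  where bound : ∀ {s} → s < suc m ⊎ s ≡ suc m → f s ≤ f t
        bound (inj₁ (s≤s q)) = max q
        bound (inj₂ refl)    = ge

-- A vertex of maximal rank on a cycle would have two different parents.
ranked⇒acyclic : ∀ {n} {S : Fin n → Fin n → Set} (rank : Fin n → ℕ) (parent : Fin n → Fin n) →
                 (∀ {u v} → S u v → S v u) →
                 (∀ {u v} → S u v → rank v ≤ rank u → v ≡ parent u) → ¬ HasCycle S
ranked⇒acyclic {S = S} rank parent S-sym low cyc = contra t≤m t-max
  where
  open PeriodicCycle (periodicCycle cyc)
  best = argmax (rank ∘ vertex) m
  t = proj₁ best
  t≤m = proj₁ (proj₂ best)
  t-max : ∀ {s} → s ≤ m → rank (vertex s) ≤ rank (vertex t)
  t-max = proj₂ (proj₂ best)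
  two : ∀ t → (∀ {s} → s ≤ m → rank (vertex s) ≤ rank (vertex (suc t))) → suc t ≤ m → ⊥
  two t max t<m = distinct {t} {suc (suc t)} (s≤s (n≤1+n t)) (+-monoˡ-≤ t 3≤m)
    (trans (low (S-sym (step t)) (max (<⇒≤ t<m))) (sym (low (step (suc t)) next)))
    where
    -- The index `suc (suc t)` may be `m + 1`, outside the range of `max`; by periodicity the vertex
    -- is then `vertex 1`.
    next : rank (vertex (suc (suc t))) ≤ rank (vertex (suc t))
    next with m≤n⇒m<n∨m≡n t<m
    ... | inj₁ lt = max lt
    ... | inj₂ e  = subst (λ z → rank z ≤ rank (vertex (suc t)))
                      (trans (sym (periodic 1)) (cong vertex (trans (+-comm m 1) (cong suc (sym e)))))
                      (max (≤-trans (s≤s z≤n) t<m))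
  contra : ∀ {t} → t ≤ m → (∀ {s} → s ≤ m → rank (vertex s) ≤ rank (vertex t)) → ⊥
  contra {suc t} t≤ max = two t max t≤
  -- Index 0 has no predecessor, so the maximum is moved to index `m`, which carries the same
  -- vertex.
  contra {zero}  _  max = wrap 3≤m
    where
    v0 : vertex 0 ≡ vertex m
    v0 = trans (sym (periodic 0)) (cong vertex (+-identityʳ m))
    wrap : 3 ≤ m → ⊥
    wrap (s≤s {n = m′} _) = two m′ (λ {s} q → subst (λ z → rank (vertex s) ≤ rank z) v0 (max q)) ≤-refl

-- Completing a family of disjoint forests to a colouring

unique⇒length≤ : ∀ {n} {xs : List (Fin n)} → Unique xs → length xs ≤ n
unique⇒length≤ {xs = []}     _    = z≤n
unique⇒length≤ {xs = x ∷ xs} uniq = injective⇒≤ {f = at x (x ∷ xs) ∘ toℕ} inj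
  where
  inj : ∀ {s t} → at x (x ∷ xs) (toℕ s) ≡ at x (x ∷ xs) (toℕ t) → s ≡ t
  inj {s} {t} e with <-cmp (toℕ s) (toℕ t)
  ... | tri< q _ _ = ⊥-elim (at-distinct uniq q (Finₚ.toℕ<n t) e)
  ... | tri≈ _ q _ = Finₚ.toℕ-injective q
  ... | tri> _ _ q = ⊥-elim (at-distinct uniq q (Finₚ.toℕ<n s) (sym e))

anyOfLength? : ∀ {n} {P : List (Fin n) → Set} → Decidable P → ∀ l → Dec (∃ λ xs → length xs ≡ l × P xs)
anyOfLength? P? zero    = map′ (λ p → [] , refl , p) (λ { ([] , _ , p) → p }) (P? [])
anyOfLength? P? (suc l) =
  map′ (λ { (x , xs , e , p) → x ∷ xs , cong suc e , p })
       (λ { (x ∷ xs , e , p) → x , xs , suc-injective e , p })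
       (any? λ x → anyOfLength? (P? ∘ (x ∷_)) l)

-- Distinct vertices number at most `n`, so finitely many lists are candidates. This decision drives
-- the merging of colours and makes the maximum computable.
hasCycle? : ∀ {n} {S : Fin n → Fin n → Set} → (∀ u v → Dec (S u v)) → Dec (HasCycle S)
hasCycle? {n} {S} S? =
  map′ (λ { (l , _ , x , ys , _ , c) → x , ys , c })
       (λ { (x , ys , c@(_ , uniq , _)) → length ys , unique⇒length≤ uniq , x , ys , refl , c })
       (anyUpTo? (λ l → any? λ x → anyOfLength? (cycle? x) l) n)
  where
  open DecUnique (Finₚ._≟_ {n}) using (unique?)
  cycle? : ∀ x → Decidable (λ ys → 2 ≤ length ys × Unique (x ∷ ys) × Linked S ((x ∷ ys) ++ (x ∷ [])))
  cycle? x ys = (2 ≤? length ys) ×-dec unique? (x ∷ ys) ×-dec linked? S? ((x ∷ ys) ++ (x ∷ []))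

module _ {n k : ℕ} (col : EdgeColoring n k) where

  colorClass? : ∀ a u v → Dec (ColorClass col a u v)
  colorClass? a u v = ¬? (u Finₚ.≟ v) ×-dec (col u v Finₚ.≟ a)

  colorClass₂? : ∀ a b u v → Dec (ColorClass₂ col a b u v)
  colorClass₂? a b u v = ¬? (u Finₚ.≟ v) ×-dec (col u v Finₚ.≟ a ⊎-dec col u v Finₚ.≟ b)

  isAchromaticArbColoring? : Dec (IsAchromaticArbColoring n k col)
  isAchromaticArbColoring? =
    (all? λ u → all? λ v → col u v Finₚ.≟ col v u)
    ×-dec (all? λ a → any? λ u → any? (colorClass? a u))
    ×-dec (all? λ a → ¬? (hasCycle? (colorClass? a)))
    ×-dec (all? λ a → all? λ b → ¬? (a Finₚ.≟ b) →-dec hasCycle? (colorClass₂? a b))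

-- Colourings are functions, and coding one by a number and decoding it recovers it only pointwise;
-- the property has to be carried along pointwise equality.
isAchromaticArbColoring-resp : ∀ {n k} {col col′ : EdgeColoring n k} → (∀ u v → col u v ≡ col′ u v) →
                               IsAchromaticArbColoring n k col → IsAchromaticArbColoring n k col′
isAchromaticArbColoring-resp {col = col} {col′} e (symm , onto , acyc , cyc) =
    (λ u v → trans (sym (e u v)) (trans (symm u v) (e v u)))
  , (λ a → let (u , v , u≢v , c) = onto a in u , v , u≢v , trans (sym (e u v)) c)
  , (λ a → acyc a ∘ hasCycle-map (λ { (d , c) → d , trans (e _ _) c }))
  , (λ a b a≢b → hasCycle-map (λ { (d , inj₁ c) → d , inj₁ (trans (sym (e _ _)) c)
                                 ; (d , inj₂ c) → d , inj₂ (trans (sym (e _ _)) c) }) (cyc a b a≢b))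

hasAchromaticArbColoring? : ∀ n k → Dec (HasAchromaticArbColoring n k)
hasAchromaticArbColoring? n k =
  map′ (λ { (c , p) → decode c , p })
       (λ { (col , p) → encode col , isAchromaticArbColoring-resp (decode-encode col) p })
       (any? (isAchromaticArbColoring? ∘ decode))
  where
  decode : Fin ((k ^ n) ^ n) → EdgeColoring n k
  decode c u = finToFun (finToFun c u)
  encode : EdgeColoring n k → Fin ((k ^ n) ^ n)
  encode col = funToFin (funToFin ∘ col)
  decode-encode : ∀ col u v → col u v ≡ decode (encode col) u v
  decode-encode col u v = sym (trans (cong (λ z → finToFun z v) (finToFun-funToFin (funToFin ∘ col) u))
                                     (finToFun-funToFin (col u) v))

-- Choosing one edge of each colour is injective, because an edge determines its colour.
hasAchromaticArbColoring⇒≤ : ∀ {n k} → HasAchromaticArbColoring n k → k ≤ n * n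
hasAchromaticArbColoring⇒≤ {n} {k} (col , _ , onto , _) = injective⇒≤ {f = edge} inj
  where
  edge : Fin k → Fin (n * n)
  edge a = let (u , v , _) = onto a in combine u v
  inj : ∀ {a b} → edge a ≡ edge b → a ≡ b
  inj {a} {b} e with onto a | onto b
  ... | u , v , _ , refl | u′ , v′ , _ , refl with combine-injective u v u′ v′ e
  ... | refl , refl = refl

maximum : {P : ℕ → Set} → Decidable P → ∀ N → (∀ {k} → P k → k ≤ N) → ∃ P →
          Σ ℕ λ A → P A × (∀ k → P k → k ≤ A)
maximum P? zero bounded (k , p) = k , p , λ j q → ≤-trans (bounded q) z≤n
maximum {P} P? (suc N) bounded ex with P? (suc N)
... | yes p = suc N , p , λ k → bounded
... | no ¬p = maximum P? N (λ {k} q → ≤-pred (≤∧≢⇒< (bounded q) (λ { refl → ¬p q }))) ex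

achromaticArboricityK : ∀ {n} → ∃ (HasAchromaticArbColoring n) → ∃ (IsAchromaticArboricityK n)
achromaticArboricityK {n} = maximum (hasAchromaticArbColoring? n) (n * n) hasAchromaticArbColoring⇒≤

-- Merging colours whose union is a forest

module Merge {K : ℕ} (a b : Fin (suc K)) (a≢b : a ≢ b) where

  -- The label `a` is deleted by `punchOut`, and its edges pass to the image of `b`.
  merge : Fin (suc K) → Fin K
  merge x with a Finₚ.≟ x
  ... | yes _  = punchOut a≢b
  ... | no a≢x = punchOut a≢x

  merge-injective : ∀ {x y} → merge x ≡ merge y → x ≡ y ⊎ ((x ≡ a ⊎ x ≡ b) × (y ≡ a ⊎ y ≡ b))
  merge-injective {x} {y} e with a Finₚ.≟ x | a Finₚ.≟ y
  ... | yes refl | yes refl = inj₁ refl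
  ... | yes refl | no a≢y   = inj₂ (inj₁ refl , inj₂ (sym (punchOut-injective a≢b a≢y e)))
  ... | no a≢x   | yes refl = inj₂ (inj₂ (punchOut-injective a≢x a≢b e) , inj₁ refl)
  ... | no a≢x   | no a≢y   = inj₁ (punchOut-injective a≢x a≢y e)

  merge-surjective : ∀ c → ∃ λ x → merge x ≡ c
  merge-surjective c = punchIn a c , eq
    where
    eq : merge (punchIn a c) ≡ c
    eq with a Finₚ.≟ punchIn a c
    ... | yes e   = ⊥-elim (Finₚ.punchInᵢ≢i a c (sym e))
    ... | no a≢   = trans (Finₚ.punchOut-cong a refl) (Finₚ.punchOut-punchIn a)


Acyclic : ∀ {n K} → EdgeColoring n K → Set
Acyclic col = ∀ a → ¬ HasCycle (ColorClass col a)

PairwiseCyclic : ∀ {n K k} → EdgeColoring n K → (Fin k → Fin K) → Set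
PairwiseCyclic col ι = ∀ x y → x ≢ y → HasCycle (ColorClass₂ col (ι x) (ι y))

colorClass₂-diag : ∀ {n K} {col : EdgeColoring n K} {a} → HasCycle (ColorClass₂ col a a) → HasCycle (ColorClass col a)
colorClass₂-diag = hasCycle-map λ { (d , inj₁ c) → d , c ; (d , inj₂ c) → d , c }

-- If `ι` took the same value at two different arguments, the union of the two classes would be a
-- single class, which is a forest. So `ι` is injective.
pairwiseCyclic⇒≤ : ∀ {n K k} {col : EdgeColoring n K} {ι : Fin k → Fin K} → Acyclic col → PairwiseCyclic col ι → k ≤ K
pairwiseCyclic⇒≤ {col = col} {ι} acyc cyc = injective⇒≤ {f = ι} inj
  where
  inj : ∀ {x y} → ι x ≡ ι y → x ≡ y
  inj {x} {y} e with x Finₚ.≟ y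
  ... | yes p = p
  ... | no ¬p = ⊥-elim (acyc (ι y) (colorClass₂-diag (subst (λ z → HasCycle (ColorClass₂ col z (ι y))) e (cyc x y ¬p))))

-- The merged class is the union of `a` and `b`, a forest by assumption, and the other classes keep
-- their edges. The classes marked by `ι` can only grow, so their cycles persist.
merge-step : ∀ {n K k} {col : EdgeColoring n (suc K)} {ι : Fin k → Fin (suc K)} {a b} (a≢b : a ≢ b) →
             ¬ HasCycle (ColorClass₂ col a b) → Acyclic col → PairwiseCyclic col ι →
             let open Merge a b a≢b in
             Acyclic (λ u v → merge (col u v)) × PairwiseCyclic (λ u v → merge (col u v)) (merge ∘ ι)
merge-step {col = col} {ι} {a} {b} a≢b ab-acyc acyc cyc = acyc′ , cyc′
  where
  open Merge a b a≢b
  acyc′ : Acyclic (λ u v → merge (col u v))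
  acyc′ c with merge-surjective c
  ... | x , refl with (x Finₚ.≟ a) ⊎-dec (x Finₚ.≟ b)
  ... | yes x∈ab = ab-acyc ∘ hasCycle-map λ { (d , e) → d , into (merge-injective e) }
    where
    into : ∀ {y} → y ≡ x ⊎ ((y ≡ a ⊎ y ≡ b) × (x ≡ a ⊎ x ≡ b)) → y ≡ a ⊎ y ≡ b
    into (inj₁ refl)    = x∈ab
    into (inj₂ (p , _)) = p
  ... | no x∉ab = acyc x ∘ hasCycle-map λ { (d , e) → d , [ (λ p → p) , (λ { (_ , q) → ⊥-elim (x∉ab q) }) ]′ (merge-injective e) }
  cyc′ : PairwiseCyclic (λ u v → merge (col u v)) (merge ∘ ι)
  cyc′ x y x≢y = hasCycle-map (λ { (d , inj₁ e) → d , inj₁ (cong merge e) ; (d , inj₂ e) → d , inj₂ (cong merge e) }) (cyc x y x≢y)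

-- Merging two colours whose union is still a forest never identifies two of the colours
-- ι x, so the process ends in a complete colouring with at least k colours.
complete-coloring : ∀ {n K k} (col : EdgeColoring n K) (ι : Fin k → Fin K) → 2 ≤ n →
                    (∀ u v → col u v ≡ col v u) → Acyclic col → PairwiseCyclic col ι →
                    Σ ℕ λ k′ → k ≤ k′ × HasAchromaticArbColoring n k′
complete-coloring {suc zero} _ _ (s≤s ()) _ _ _
complete-coloring {suc (suc n)} {zero} col _ _ _ _ _ with col zero zero
... | ()
complete-coloring {n@(suc (suc _))} {suc K} {k} col ι 2≤n symm acyc cyc
  with any? (λ a → any? λ b → ¬? (a Finₚ.≟ b) ×-dec ¬? (hasCycle? (colorClass₂? col a b)))
... | yes (a , b , a≢b , ab-acyc) =
      let (acyc′ , cyc′) = merge-step a≢b ab-acyc acyc cyc in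
      complete-coloring (λ u v → merge (col u v)) (merge ∘ ι) 2≤n (λ u v → cong merge (symm u v)) acyc′ cyc′
      where open Merge a b a≢b
... | no none = suc K , pairwiseCyclic⇒≤ acyc cyc , col , symm , onto K refl , acyc , full
  where
  full : ∀ a b → a ≢ b → HasCycle (ColorClass₂ col a b)
  full a b a≢b = decidable-stable (hasCycle? (colorClass₂? col a b)) (λ ¬c → none (a , b , a≢b , ¬c))
  -- If `a` had no edge, its union with `b` would be the class `b` alone, a forest.
  used : ∀ a b → a ≢ b → Σ (Fin n) λ u → Σ (Fin n) λ v → (u ≢ v) × (col u v ≡ a)
  used a b a≢b with any? (λ u → any? (colorClass? col a u))
  ... | yes w = w
  ... | no ¬w = ⊥-elim (acyc b (hasCycle-map
          (λ { (d , inj₁ e) → ⊥-elim (¬w (_ , _ , d , e)) ; (d , inj₂ e) → d , e }) (full a b a≢b)))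
  -- A single colour has no partner to compare with; the edge between the first two vertices then
  -- witnesses that it occurs.
  onto : ∀ K′ → K′ ≡ K → ∀ a → Σ (Fin n) λ u → Σ (Fin n) λ v → (u ≢ v) × (col u v ≡ a)
  onto zero    refl zero = zero , suc zero , (λ ()) , only (col zero (suc zero))
    where only : (x : Fin 1) → x ≡ zero
          only zero = refl
  onto (suc _) refl zero = used zero (suc zero) (λ ())
  onto (suc _) refl (suc a) = used (suc a) zero (λ ())

-- Disjoint forests and private colours for the remaining edges

sort₂ : ∀ {n} → Fin n → Fin n → Fin n × Fin n
sort₂ u v with toℕ u ≤? toℕ v
... | yes _ = u , v
... | no _  = v , u

sort₂-comm : ∀ {n} (u v : Fin n) → sort₂ u v ≡ sort₂ v u
sort₂-comm u v with toℕ u ≤? toℕ v | toℕ v ≤? toℕ u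
... | yes p | yes q with Finₚ.toℕ-injective (≤-antisym p q)
...   | refl = refl
sort₂-comm u v | yes p | no q  = refl
sort₂-comm u v | no p  | yes q = refl
sort₂-comm u v | no p  | no q  = ⊥-elim ([ p , q ]′ (≤-total (toℕ u) (toℕ v)))

sort₂-cancel : ∀ {n} {u v w : Fin n} → sort₂ u v ≡ sort₂ u w → v ≡ w
sort₂-cancel {_} {u} {v} {w} e with toℕ u ≤? toℕ v | toℕ u ≤? toℕ w
... | yes _ | yes _ = cong proj₂ e
... | yes _ | no _  = trans (cong proj₂ e) (cong proj₁ e)
... | no _  | yes _ = trans (cong proj₁ e) (cong proj₂ e)
... | no _  | no _  = cong proj₁ e

↑ˡ≢↑ʳ : ∀ {k l} (c : Fin k) (p : Fin l) → c ↑ˡ l ≢ k ↑ʳ p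
↑ˡ≢↑ʳ {k} {l} c p e with trans (sym (Finₚ.splitAt-↑ˡ k c l)) (trans (cong (Fin.splitAt k) e) (Finₚ.splitAt-↑ʳ k l p))
... | ()

module Packing {n k : ℕ} (E : Fin k → Fin n → Fin n → Set) (E? : ∀ c u v → Dec (E c u v))
               (E-sym : ∀ {c u v} → E c u v → E c v u)
               (disjoint : ∀ {c c′ u v} → E c u v → E c′ u v → c ≡ c′) where

  -- Sorting the endpoints makes the code symmetric. Codes that no remaining edge receives are empty
  -- colours, which `complete-coloring` merges away.
  private-color : Fin n → Fin n → Fin (n * n)
  private-color u v = combine (proj₁ (sort₂ u v)) (proj₂ (sort₂ u v))

  find : ∀ u v → Dec (∃ λ c → E c u v)
  find u v = any? λ c → E? c u v

  color : ∀ u v → Dec (∃ λ c → E c u v) → Fin (k + n * n)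
  color u v (yes (c , _)) = c ↑ˡ (n * n)
  color u v (no _)        = k ↑ʳ private-color u v

  packed : EdgeColoring n (k + n * n)
  packed u v = color u v (find u v)

  packed-sym : ∀ u v → packed u v ≡ packed v u
  packed-sym u v with find u v | find v u
  ... | yes (c , e) | yes (c′ , e′) = cong (_↑ˡ (n * n)) (disjoint e (E-sym e′))
  ... | yes (c , e) | no ∄          = ⊥-elim (∄ (c , E-sym e))
  ... | no ∄        | yes (c , e)   = ⊥-elim (∄ (c , E-sym e))
  ... | no _        | no _          = cong (λ p → k ↑ʳ combine (proj₁ p) (proj₂ p)) (sort₂-comm u v)

  packed-complete : ∀ {c u v} → E c u v → packed u v ≡ c ↑ˡ (n * n)
  packed-complete {c} {u} {v} e with find u v
  ... | yes (c′ , e′) = cong (_↑ˡ (n * n)) (disjoint e′ e)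
  ... | no ∄          = ⊥-elim (∄ (c , e))

  packed-sound : ∀ {c u v} → packed u v ≡ c ↑ˡ (n * n) → E c u v
  packed-sound {c} {u} {v} eq with find u v
  ... | yes (c′ , e) = subst (λ z → E z u v) (Finₚ.↑ˡ-injective (n * n) c′ c eq) e
  ... | no _         = ⊥-elim (↑ˡ≢↑ʳ c _ (sym eq))

  packed-private : ∀ {p u v} → packed u v ≡ k ↑ʳ p → private-color u v ≡ p
  packed-private {p} {u} {v} eq with find u v
  ... | yes (c , _) = ⊥-elim (↑ˡ≢↑ʳ c p eq)
  ... | no _        = Finₚ.↑ʳ-injective k _ _ eq

  private-color-cancel : ∀ {u v w} → private-color u v ≡ private-color u w → v ≡ w
  private-color-cancel {u} {v} {w} e =
    let (e₁ , e₂) = combine-injective _ _ (proj₁ (sort₂ u w)) (proj₂ (sort₂ u w)) e in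
    sort₂-cancel {u = u} (cong₂ _,_ e₁ e₂)

  packed-acyclic : (∀ c → ¬ HasCycle (λ u v → u ≢ v × E c u v)) → Acyclic packed
  packed-acyclic acyc a with Fin.splitAt k a in eq
  ... | inj₁ c = acyc c ∘ hasCycle-map λ { (d , e) → d , packed-sound (trans e (sym (Finₚ.splitAt⁻¹-↑ˡ eq))) }
  -- In a private class every vertex has at most one neighbour, so a constant rank suffices and
  -- `parent` looks that neighbour up.
  ... | inj₂ p = ranked⇒acyclic (λ _ → 0) parent (λ { (d , e) → d ∘ sym , trans (packed-sym _ _) e })
                   (λ { {u} {v} (_ , e) _ → only u v (packed-private (trans e (sym (Finₚ.splitAt⁻¹-↑ʳ eq)))) })
    where
    parent : Fin n → Fin n
    parent u with any? (λ v → private-color u v Finₚ.≟ p)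
    ... | yes (v , _) = v
    ... | no _        = u
    only : ∀ u v → private-color u v ≡ p → v ≡ parent u
    only u v e with any? (λ v → private-color u v Finₚ.≟ p)
    ... | yes (w , f) = private-color-cancel {u} (trans e (sym f))
    ... | no ∄        = ⊥-elim (∄ (v , e))

  packing⇒coloring : 2 ≤ n → (∀ c → ¬ HasCycle (λ u v → u ≢ v × E c u v)) →
                     (∀ c c′ → c ≢ c′ → HasCycle (λ u v → u ≢ v × (E c u v ⊎ E c′ u v))) →
                     Σ ℕ λ k′ → k ≤ k′ × HasAchromaticArbColoring n k′
  packing⇒coloring 2≤n acyc cyc = complete-coloring packed (_↑ˡ (n * n)) 2≤n packed-sym (packed-acyclic acyc)
    λ c c′ c≢c′ → hasCycle-map (λ { (d , inj₁ e) → d , inj₁ (packed-complete e)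
                                  ; (d , inj₂ e) → d , inj₂ (packed-complete e) }) (cyc c c′ c≢c′)

-- The double stars

-- The binomial coefficient `v` over 2, in the recursive form along which `pair` splits.
triangle : ℕ → ℕ
triangle zero    = 0
triangle (suc v) = triangle v + v

-- Enumerates the pairs of rows by their larger element: the last `v` codes below `triangle (suc v)`
-- are the pairs with larger row `v`.
pair : ∀ v → Fin (triangle v) → Fin v × Fin v
pair (suc v) p with Fin.splitAt (triangle v) p
... | inj₁ q = inject₁ (proj₁ (pair v q)) , inject₁ (proj₂ (pair v q))
... | inj₂ i = inject₁ i , fromℕ v

pair-< : ∀ v p → toℕ (proj₁ (pair v p)) < toℕ (proj₂ (pair v p))
pair-< (suc v) p with Fin.splitAt (triangle v) p
... | inj₁ q = subst₂ _<_ (sym (Finₚ.toℕ-inject₁ _)) (sym (Finₚ.toℕ-inject₁ _)) (pair-< v q)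
... | inj₂ i = subst₂ _<_ (sym (Finₚ.toℕ-inject₁ i)) (sym (Finₚ.toℕ-fromℕ v)) (Finₚ.toℕ<n i)

pair-injective : ∀ v {p q} → proj₁ (pair v p) ≡ proj₁ (pair v q) → proj₂ (pair v p) ≡ proj₂ (pair v q) → p ≡ q
pair-injective (suc v) {p} {q} e₁ e₂ with Fin.splitAt (triangle v) p in eqp | Fin.splitAt (triangle v) q in eqq
... | inj₁ p′ | inj₁ q′ = trans (sym (Finₚ.splitAt⁻¹-↑ˡ eqp)) (trans
        (cong (_↑ˡ v) (pair-injective v (inject₁-injective e₁) (inject₁-injective e₂))) (Finₚ.splitAt⁻¹-↑ˡ eqq))
... | inj₁ p′ | inj₂ _  = ⊥-elim (Finₚ.fromℕ≢inject₁ (sym e₂))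
... | inj₂ _  | inj₁ q′ = ⊥-elim (Finₚ.fromℕ≢inject₁ e₂)
... | inj₂ i  | inj₂ i′ = trans (sym (Finₚ.splitAt⁻¹-↑ʳ eqp)) (trans
        (cong (triangle v ↑ʳ_) (inject₁-injective e₁)) (Finₚ.splitAt⁻¹-↑ʳ eqq))

inject₁≢suc : ∀ {v} (j : Fin v) → inject₁ j ≢ suc j
inject₁≢suc j e = m≢1+n+m (toℕ j) {0} (trans (sym (Finₚ.toℕ-inject₁ j)) (cong toℕ e))

module Stars {n : ℕ} (v : ℕ) (g : Fin v → Fin (suc v) → Fin n) (w : Fin (triangle v) → Fin n)
             (g-injective : ∀ {i j i′ j′} → g i j ≡ g i′ j′ → i ≡ i′ × j ≡ j′)
             (w-injective : ∀ {p q} → w p ≡ w q → p ≡ q)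
             (g≢w : ∀ {i j p} → g i j ≢ w p) where

  Color : Set
  Color = Fin (triangle v * v)

  idx : Color → Fin (triangle v)
  idx c = proj₁ (remQuot v c)

  low high : Color → Fin v
  low  c = proj₁ (pair v (idx c))
  high c = proj₂ (pair v (idx c))

  pos : Color → Fin v
  pos c = proj₂ (remQuot {triangle v} v c)

  color-injective : ∀ {c c′} → idx c ≡ idx c′ → pos c ≡ pos c′ → c ≡ c′
  color-injective {c} {c′} e₁ e₂ = trans (sym (Finₚ.combine-remQuot {triangle v} v c))
    (trans (cong₂ combine e₁ e₂) (Finₚ.combine-remQuot {triangle v} v c′))

  low<high : ∀ c → toℕ (low c) < toℕ (high c)
  low<high c = pair-< v (idx c)

  low≢high : ∀ c → low c ≢ high c
  low≢high c e = <-irrefl (cong toℕ e) (low<high c)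

  g≢-row : ∀ {i i′ j j′} → i ≢ i′ → g i j ≢ g i′ j′
  g≢-row i≢i′ = i≢i′ ∘ proj₁ ∘ g-injective

  g≢-col : ∀ {i i′ j j′} → j ≢ j′ → g i j ≢ g i′ j′
  g≢-col j≢j′ = j≢j′ ∘ proj₂ ∘ g-injective

  w≢g : ∀ {i j p} → w p ≢ g i j
  w≢g = g≢w ∘ sym

  -- The row star is centred in column pos c and the column star covers the next column: in a common
  -- column the two stars would close a triangle.
  A B : Color → Fin n
  A c = g (low c) (inject₁ (pos c))
  B c = w (idx c)

  col : Color → Fin (suc v)
  col c = suc (pos c)

  Star : Color → Fin n → Fin n → Set
  Star c u x = (u ≡ A c × ∃ λ b → x ≡ g (high c) b) ⊎ (u ≡ B c × ∃ λ b → x ≡ g b (col c))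

  E : Color → Fin n → Fin n → Set
  E c u x = Star c u x ⊎ Star c x u

  E? : ∀ c u x → Dec (E c u x)
  E? c u x = star? u x ⊎-dec star? x u
    where
    star? : ∀ u x → Dec (Star c u x)
    star? u x = ((u Finₚ.≟ A c) ×-dec any? λ b → x Finₚ.≟ g (high c) b)
          ⊎-dec ((u Finₚ.≟ B c) ×-dec any? λ b → x Finₚ.≟ g b (col c))

  star-centre : ∀ {c u x} → Star c u x → u ≡ A c ⊎ u ≡ B c
  star-centre (inj₁ (e , _)) = inj₁ e
  star-centre (inj₂ (e , _)) = inj₂ e

  star-leaf : ∀ {c u x} → Star c u x → ¬ (x ≡ A c ⊎ x ≡ B c)
  star-leaf {c} (inj₁ (_ , b , refl)) = [ g≢-row (low≢high c ∘ sym) , g≢w ]′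
  star-leaf {c} (inj₂ (_ , b , refl)) = [ g≢-col (inject₁≢suc (pos c) ∘ sym) , g≢w ]′

  -- A grid centre reveals `low c` and `pos c`, and its leaf reveals `high c`; a centre `w p`
  -- reveals the pair of rows, and its leaf the column.
  star-unique : ∀ {c c′ u x} → Star c u x → Star c′ u x → c ≡ c′
  star-unique (inj₁ (refl , b , refl)) (inj₁ (e , b′ , e′)) =
    let (l , p) = g-injective e in
    color-injective (pair-injective v l (proj₁ (g-injective e′))) (inject₁-injective p)
  star-unique (inj₁ (refl , _)) (inj₂ (e , _)) = ⊥-elim (g≢w e)
  star-unique (inj₂ (refl , _)) (inj₁ (e , _)) = ⊥-elim (w≢g e)
  star-unique (inj₂ (refl , b , refl)) (inj₂ (e , b′ , e′)) =
    color-injective (w-injective e) (Finₚ.suc-injective (proj₂ (g-injective e′)))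

  -- Row stars lead from a lower row to a higher one, and the vertices `w p` are never leaves. Hence
  -- no edge is used in opposite directions, even by two colours.
  star-oriented : ∀ {c c′ u x} → Star c u x → ¬ Star c′ x u
  star-oriented {c} {c′} (inj₁ (refl , b , refl)) (inj₁ (e , b′ , e′)) =
    <-asym (low<high c) (subst₂ (λ y z → toℕ y < toℕ z) (sym (proj₁ (g-injective e))) (sym (proj₁ (g-injective e′))) (low<high c′))
  star-oriented (inj₁ (_ , _ , refl)) (inj₂ (e , _))     = g≢w e
  star-oriented (inj₂ (refl , _))     (inj₁ (_ , _ , e)) = w≢g e
  star-oriented (inj₂ (refl , _))     (inj₂ (_ , _ , e)) = w≢g e

  disjoint : ∀ {c c′ u x} → E c u x → E c′ u x → c ≡ c′
  disjoint (inj₁ s) (inj₁ t) = star-unique s t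
  disjoint (inj₁ s) (inj₂ t) = ⊥-elim (star-oriented s t)
  disjoint (inj₂ s) (inj₁ t) = ⊥-elim (star-oriented t s)
  disjoint (inj₂ s) (inj₂ t) = star-unique s t

  E-irrefl : ∀ {c u x} → E c u x → u ≢ x
  E-irrefl (inj₁ s) refl = star-oriented s s
  E-irrefl (inj₂ s) refl = star-oriented s s

  module Acyclicity (c : Color) where

    -- The common leaf of the row star and the column star. Rooted at `Z`, the double star is a tree
    -- of depth 2, and `rank` is the depth.
    Z : Fin n
    Z = g (high c) (col c)

    -- `other` holds the column leaves apart from `Z` together with the vertices off the double
    -- star, which have no neighbours in it.
    data Node (x : Fin n) : Set where
      centre  : x ≡ A c ⊎ x ≡ B c → Node x
      joint   : x ≡ Z → Node x
      rowLeaf : x ≢ Z → (∃ λ b → x ≡ g (high c) b) → Node x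
      other   : ¬ (x ≡ A c ⊎ x ≡ B c) → ¬ (∃ λ b → x ≡ g (high c) b) → Node x

    node : ∀ x → Node x
    node x with (x Finₚ.≟ A c) ⊎-dec (x Finₚ.≟ B c) | x Finₚ.≟ Z | any? (λ b → x Finₚ.≟ g (high c) b)
    ... | yes p | _     | _     = centre p
    ... | no _  | yes p | _     = joint p
    ... | no _  | no q  | yes p = rowLeaf q p
    ... | no p  | no _  | no q  = other p q

    rank : ∀ {x} → Node x → ℕ
    rank (centre _)    = 1
    rank (joint _)     = 0
    rank (rowLeaf _ _) = 2
    rank (other _ _)   = 2

    parent : ∀ {x} → Node x → Fin n
    parent (centre _)    = Z
    parent (joint _)     = Z
    parent (rowLeaf _ _) = A c
    parent (other _ _)   = B c

    low-neighbour : ∀ {x y} (nx : Node x) (ny : Node y) → E c x y → rank ny ≤ rank nx → y ≡ parent nx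
    low-neighbour (centre p) (centre q) (inj₁ s) _ = ⊥-elim (star-leaf s q)
    low-neighbour (centre p) (centre q) (inj₂ s) _ = ⊥-elim (star-leaf s p)
    low-neighbour (centre p) (joint q) _ _ = q
    low-neighbour (centre p) (rowLeaf _ _) _ (s≤s ())
    low-neighbour (centre p) (other _ _) _ (s≤s ())
    low-neighbour (joint p) (joint q) _ _ = q
    low-neighbour (rowLeaf _ (b , refl)) _ (inj₁ (inj₁ (e , _))) _ = ⊥-elim (g≢-row (low≢high c ∘ sym) e)
    low-neighbour (rowLeaf _ (b , refl)) _ (inj₁ (inj₂ (e , _))) _ = ⊥-elim (g≢w e)
    low-neighbour (rowLeaf _ _) _ (inj₂ (inj₁ (e , _))) _ = e
    low-neighbour (rowLeaf ≢Z (b , refl)) _ (inj₂ (inj₂ (_ , b′ , e))) _ =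
      ⊥-elim (≢Z (cong (g (high c)) (proj₂ (g-injective e))))
    low-neighbour (other ∉ _) _ (inj₁ s) _ = ⊥-elim (∉ (star-centre s))
    low-neighbour (other _ ∉row) _ (inj₂ (inj₁ (_ , r))) _ = ⊥-elim (∉row r)
    low-neighbour (other _ _) _ (inj₂ (inj₂ (e , _))) _ = e

    acyclic : ¬ HasCycle (λ u x → u ≢ x × E c u x)
    acyclic = ranked⇒acyclic (rank ∘ node) (parent ∘ node) (λ { (d , e) → d ∘ sym , swap e })
                (λ { {u} {x} (_ , e) → low-neighbour (node u) (node x) e })

  E₂ : Color → Color → Fin n → Fin n → Set
  E₂ c c′ u x = u ≢ x × (E c u x ⊎ E c′ u x)

  edge : ∀ {c c′ u x} → E c u x → E₂ c c′ u x
  edge e = E-irrefl e , inj₁ e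

  edge′ : ∀ {c c′ u x} → E c′ u x → E₂ c c′ u x
  edge′ e = E-irrefl e , inj₂ e

  row-star : ∀ {c} b → Star c (A c) (g (high c) b)
  row-star b = inj₁ (refl , b , refl)

  col-star : ∀ {c} a → Star c (B c) (g a (col c))
  col-star a = inj₂ (refl , a , refl)

  -- The two row stars share all their leaves, so their centres and any two of these leaves form a
  -- four-cycle. Column `zero` differs from `col c`, which is a successor.
  same-row : ∀ {c c′} → high c ≡ high c′ → A c ≢ A c′ → HasCycle (E₂ c c′)
  same-row {c} {c′} h A≢A′ = A c , x ∷ A c′ ∷ y ∷ [] , s≤s (s≤s z≤n) ,
    ((g≢-row (low≢high c) ∷ A≢A′ ∷ g≢-row (low≢high c) ∷ [])
    ∷ (star-leaf′ zero ∷ g≢-col (λ ()) ∷ [])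
    ∷ ((star-leaf′ (col c) ∘ sym) ∷ [])
    ∷ [] ∷ []) ,
    edge (inj₁ (row-star zero)) ∷ edge′ (inj₂ (star′ zero)) ∷ edge′ (inj₁ (star′ (col c)))
      ∷ edge (inj₂ (row-star (col c))) ∷ [-]
    where
    x = g (high c) zero
    y = g (high c) (col c)
    star′ : ∀ b → Star c′ (A c′) (g (high c) b)
    star′ b = inj₁ (refl , b , cong (λ z → g z b) h)
    star-leaf′ : ∀ b → g (high c) b ≢ A c′
    star-leaf′ b = star-leaf (star′ b) ∘ inj₁

  -- Dually, the two column stars share all their leaves; those in the rows `low c` and `high c` are
  -- taken.
  same-col : ∀ {c c′} → pos c ≡ pos c′ → idx c ≢ idx c′ → HasCycle (E₂ c c′)
  same-col {c} {c′} h p≢p′ = B c , x ∷ B c′ ∷ y ∷ [] , s≤s (s≤s z≤n) ,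
    ((w≢g ∷ p≢p′ ∘ w-injective ∷ w≢g ∷ [])
    ∷ (g≢w ∷ g≢-row (low≢high c) ∷ [])
    ∷ (w≢g ∷ [])
    ∷ [] ∷ []) ,
    edge (inj₁ (col-star (low c))) ∷ edge′ (inj₂ (star′ (low c))) ∷ edge′ (inj₁ (star′ (high c)))
      ∷ edge (inj₂ (col-star (high c))) ∷ [-]
    where
    x = g (low c) (col c)
    y = g (high c) (col c)
    star′ : ∀ a → Star c′ (B c′) (g a (col c))
    star′ a = inj₂ (refl , a , cong (λ z → g a (suc z)) h)

  module General {c c′ : Color} (a≢a′ : high c ≢ high c′) (j≢j′ : pos c ≢ pos c′) where

    p≢p′ : idx c ≢ idx c′
    p≢p′ = a≢a′ ∘ cong (proj₂ ∘ pair v)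

    A≢A′ : A c ≢ A c′
    A≢A′ = g≢-col (j≢j′ ∘ inject₁-injective)

    s≢s′ : col c ≢ col c′
    s≢s′ = j≢j′ ∘ Finₚ.suc-injective

    -- Each row star meets each column star in one leaf. The cycle passes through the centres `A c`,
    -- `B c`, `A c′`, `B c′` in turn, using the common leaf of consecutive stars. The hypotheses
    -- exclude the only possible coincidences, those of a grid centre with the joint of the other
    -- colour.
    eight-cycle : A c ≢ g (high c′) (col c′) → A c′ ≢ g (high c) (col c) → HasCycle (E₂ c c′)
    eight-cycle A∉ A′∉ =
      A c , g (high c) (col c) ∷ B c ∷ g (high c′) (col c) ∷ A c′ ∷ g (high c′) (col c′) ∷ B c′ ∷ g (high c) (col c′) ∷ [] ,
      s≤s (s≤s z≤n) ,
      ((g≢-row (low≢high c) ∷ g≢w ∷ g≢-col (inject₁≢suc (pos c)) ∷ A≢A′ ∷ A∉ ∷ g≢w ∷ g≢-row (low≢high c) ∷ [])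
      ∷ (g≢w ∷ g≢-row a≢a′ ∷ (A′∉ ∘ sym) ∷ g≢-row a≢a′ ∷ g≢w ∷ g≢-col s≢s′ ∷ [])
      ∷ (w≢g ∷ w≢g ∷ w≢g ∷ p≢p′ ∘ w-injective ∷ w≢g ∷ [])
      ∷ (g≢-row (low≢high c′ ∘ sym) ∷ g≢-col s≢s′ ∷ g≢w ∷ g≢-row (a≢a′ ∘ sym) ∷ [])
      ∷ (g≢-row (low≢high c′) ∷ g≢w ∷ g≢-col (inject₁≢suc (pos c′)) ∷ [])
      ∷ (g≢w ∷ g≢-row (a≢a′ ∘ sym) ∷ [])
      ∷ (w≢g ∷ [])
      ∷ [] ∷ []) ,
      edge (inj₁ (row-star _)) ∷ edge (inj₂ (col-star _)) ∷ edge (inj₁ (col-star _)) ∷ edge′ (inj₂ (row-star _))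
      ∷ edge′ (inj₁ (row-star _)) ∷ edge′ (inj₂ (col-star _)) ∷ edge′ (inj₁ (col-star _)) ∷ edge (inj₂ (row-star _)) ∷ [-]

    -- The eight-cycle degenerates if A c is the joint of the double star c′.
    five-cycle : A c ≡ g (high c′) (col c′) → HasCycle (E₂ c c′)
    five-cycle A∈ =
      B c , g (high c′) (col c) ∷ A c′ ∷ A c ∷ g (high c) (col c) ∷ [] , s≤s (s≤s z≤n) ,
      ((w≢g ∷ w≢g ∷ w≢g ∷ w≢g ∷ [])
      ∷ (g≢-row (low≢high c′ ∘ sym) ∷ g≢-col (inject₁≢suc (pos c) ∘ sym) ∷ g≢-row (a≢a′ ∘ sym) ∷ [])
      ∷ ((A≢A′ ∘ sym) ∷ A′∉ ∷ [])
      ∷ (g≢-row (low≢high c) ∷ [])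
      ∷ [] ∷ []) ,
      edge (inj₁ (col-star _)) ∷ edge′ (inj₂ (row-star _)) ∷ edge′ (inj₁ (inj₁ (refl , _ , A∈)))
      ∷ edge (inj₁ (row-star _)) ∷ edge (inj₂ (col-star _)) ∷ [-]
      where
      A′∉ : A c′ ≢ g (high c) (col c)
      -- Both coincidences at once would give `low c` < `high c` = `low c′` < `high c′` = `low c`.
      A′∉ e = <-asym (low<high c)
        (subst₂ (λ y z → toℕ y < toℕ z) (proj₁ (g-injective e)) (sym (proj₁ (g-injective A∈))) (low<high c′))

  cyclic : ∀ c c′ → c ≢ c′ → HasCycle (E₂ c c′)
  cyclic c c′ c≢c′ with high c Finₚ.≟ high c′ | pos c Finₚ.≟ pos c′
  ... | yes h | _ = same-row h λ e → let (l , p) = g-injective e in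
                      c≢c′ (color-injective (pair-injective v l h) (inject₁-injective p))
  ... | no _  | yes h = same-col h λ p → c≢c′ (color-injective p h)
  ... | no a≢ | no j≢ with A c Finₚ.≟ g (high c′) (col c′) | A c′ Finₚ.≟ g (high c) (col c)
  ...   | yes e | _     = General.five-cycle a≢ j≢ e
  ...   | no _  | yes e = hasCycle-map (λ { (d , e) → d , swap e }) (General.five-cycle (a≢ ∘ sym) (j≢ ∘ sym) e)
  ...   | no p  | no q  = General.eight-cycle a≢ j≢ p q

  coloring : 2 ≤ n → Σ ℕ λ k′ → triangle v * v ≤ k′ × HasAchromaticArbColoring n k′
  coloring 2≤n = Packing.packing⇒coloring E E? swap disjoint 2≤n Acyclicity.acyclic cyclic

grid-coloring : ∀ {n} v → v * suc v + triangle v ≤ n → 2 ≤ n →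
                Σ ℕ λ k → triangle v * v ≤ k × HasAchromaticArbColoring n k
grid-coloring {n} v fits = Stars.coloring v g w g-injective
  (λ e → Finₚ.↑ʳ-injective (v * suc v) _ _ (Finₚ.inject≤-injective fits fits _ _ e))
  (λ e → ↑ˡ≢↑ʳ _ _ (Finₚ.inject≤-injective fits fits _ _ e))
  where
  g : Fin v → Fin (suc v) → Fin n
  g i j = inject≤ (combine i j ↑ˡ triangle v) fits
  w : Fin (triangle v) → Fin n
  w p = inject≤ ((v * suc v) ↑ʳ p) fits
  g-injective : ∀ {i j i′ j′} → g i j ≡ g i′ j′ → i ≡ i′ × j ≡ j′
  g-injective {i} {j} {i′} {j′} e = combine-injective i j i′ j′
    (Finₚ.↑ˡ-injective (triangle v) _ _ (Finₚ.inject≤-injective fits fits _ _ e))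

-- Cycles in the union of two colours

module _ {n : ℕ} {S : Fin n → Fin n → Set} (C : PeriodicCycle S) where
  open PeriodicCycle C

  -- Used with one of the two colours as `R`: a cycle in the union that kept to a single colour
  -- would contradict that class being a forest.
  closed-walk⇒hasCycle : {R : Fin n → Fin n → Set} → (∀ {t} → t < m → R (vertex t) (vertex (suc t))) → HasCycle R
  closed-walk⇒hasCycle {R} steps = build m 3≤m distinct₀ steps (trans (cong vertex (sym (+-identityʳ m))) (periodic 0))
    where
    distinct₀ : ∀ {s t} → s < t → t < m → vertex s ≢ vertex t
    distinct₀ s<t t<m = distinct s<t (≤-trans t<m (m≤m+n m _))
    build : ∀ m → 3 ≤ m → (∀ {s t} → s < t → t < m → vertex s ≢ vertex t) →
            (∀ {t} → t < m → R (vertex t) (vertex (suc t))) → vertex m ≡ vertex 0 → HasCycle R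
    build (suc m) (s≤s 2≤m) dist st e =
        vertex 0 , applyUpTo (vertex ∘ suc) m
      , subst (2 ≤_) (sym (length-applyUpTo (vertex ∘ suc) m)) 2≤m
      , Uniqueₚ.applyUpTo⁺₁ vertex (suc m) dist
      , subst (Linked R) (trans (sym (applyUpTo-∷ʳ vertex (suc m))) (cong (λ z → applyUpTo vertex (suc m) ++ (z ∷ [])) e))
          (Linkedₚ.applyUpTo⁺₁ vertex (suc (suc m)) (λ { (s≤s lt) → st lt }))

switch : ∀ {P : ℕ → Set} → Decidable P → ∀ {a b} → P a → a ≤ b → ¬ P b →
         Σ ℕ λ t → a ≤ t × t < b × P t × ¬ P (suc t)
switch P? {a} {zero} pa z≤n ¬pb = ⊥-elim (¬pb pa)
switch P? {a} {suc b} pa a≤b ¬pb with m≤n⇒m<n∨m≡n a≤b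
... | inj₂ refl = ⊥-elim (¬pb pa)
... | inj₁ (s≤s a≤) with P? b
... | yes pb = b , a≤ , ≤-refl , pb , ¬pb
... | no ¬q  = let (t , p , q , r) = switch P? pa a≤ ¬q in t , p , m≤n⇒m≤1+n q , r

module Union {n k : ℕ} (col : EdgeColoring n k) (col-sym : ∀ u v → col u v ≡ col v u)
             {i j : Fin k} (i≢j : i ≢ j) where

  -- `Deep u` makes `u` an end of a path of two `i`-edges.
  Covered Deep : Fin n → Set
  Covered u = ∃ λ v → ColorClass col i u v
  Deep u    = ∃ λ v → ColorClass col i u v × ∃ λ w → w ≢ u × ColorClass col i v w

  -- The last two inequalities keep `u′` off the edge `u v`, which makes the two edges different as
  -- unordered pairs.
  TwoEdges InnerEdge : Set
  TwoEdges = Σ (Fin n) λ u → Σ (Fin n) λ v → Σ (Fin n) λ u′ → Σ (Fin n) λ v′ →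
    ColorClass col j u v × Covered u × ColorClass col j u′ v′ × Covered u′ × u ≢ u′ × v ≢ u′
  InnerEdge = Σ (Fin n) λ u → Σ (Fin n) λ v → ColorClass col j u v × Deep u × Deep v

  reverse : ∀ {c u v} → ColorClass col c u v → ColorClass col c v u
  reverse (u≢v , e) = u≢v ∘ sym , trans (col-sym _ _) e

  module Walk (C : PeriodicCycle (ColorClass₂ col i j)) where
    open PeriodicCycle C

    I J : ℕ → Set
    I t = ColorClass col i (vertex t) (vertex (suc t))
    J t = ColorClass col j (vertex t) (vertex (suc t))

    I? : Decidable I
    I? t = colorClass? col i _ _

    J? : Decidable J
    J? t = colorClass? col j _ _

    ¬I⇒J : ∀ {t} → ¬ I t → J t
    ¬I⇒J {t} ¬i with step t
    ... | d , inj₁ e = ⊥-elim (¬i (d , e))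
    ... | d , inj₂ e = d , e

    ¬J⇒I : ∀ {t} → ¬ J t → I t
    ¬J⇒I {t} ¬j with step t
    ... | d , inj₁ e = d , e
    ... | d , inj₂ e = ⊥-elim (¬j (d , e))

    I⇒¬J : ∀ {t} → I t → ¬ J t
    I⇒¬J (_ , e) (_ , e′) = i≢j (trans (sym e) e′)

    vertex-m+ : ∀ t → vertex (t + m) ≡ vertex t
    vertex-m+ t = trans (cong vertex (+-comm t m)) (periodic t)

    I-periodic : ∀ t → I t → I (t + m)
    I-periodic t = subst₂ (ColorClass col i) (sym (vertex-m+ t)) (sym (vertex-m+ (suc t)))

    J-periodic : ∀ t → J t → J (t + m)
    J-periodic t = subst₂ (ColorClass col j) (sym (vertex-m+ t)) (sym (vertex-m+ (suc t)))

    start : ¬ HasCycle (ColorClass col i) → ¬ HasCycle (ColorClass col j) → Σ ℕ λ t → I t × J (suc t)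
    start ¬ci ¬cj with anyUpTo? I? m | anyUpTo? J? m
    ... | no ∄ | _ = ⊥-elim (¬cj (closed-walk⇒hasCycle C λ t< → ¬I⇒J λ p → ∄ (_ , t< , p)))
    ... | yes _ | no ∄ = ⊥-elim (¬ci (closed-walk⇒hasCycle C λ t< → ¬J⇒I λ p → ∄ (_ , t< , p)))
    ... | yes (a , a<m , ia) | yes (b , _ , jb) =
      -- The `j`-step at `b` is moved one period ahead so that it comes after the `i`-step at `a`.
      let (t , _ , _ , it , ¬it) = switch I? ia (≤-trans (<⇒≤ a<m) (m≤n+m m b)) (λ p → I⇒¬J p (J-periodic b jb))
      in t , it , ¬I⇒J ¬it

    far : ∀ {t} → 3 ≤ t → t ≤ m → vertex 1 ≢ vertex t × vertex 2 ≢ vertex t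
    far 3≤t t≤m = distinct (≤-trans (s≤s (s≤s z≤n)) 3≤t) (≤-trans (s≤s t≤m) (≤-reflexive (+-comm 1 m)))
                , distinct 3≤t (≤-trans (s≤s t≤m) (≤-trans (n≤1+n (suc m)) (≤-reflexive (+-comm 2 m))))

    -- Vertex 1 is covered, so the `j`-edge from 1 to 2 is a first edge. If step 2 is also of colour
    -- `j`, the last edge of that run ends at a covered vertex. If step 2 has colour `i` and a
    -- further `j`-edge occurs, some run of `i`-edges ends where a `j`-edge begins. Otherwise the
    -- rest of the cycle is an `i`-path with at least two edges, and both its ends are deep.
    from-start : I 0 → J 1 → TwoEdges ⊎ InnerEdge
    from-start i₀ j₁ with J? 2
    ... | yes j₂ =
      let (t , 2≤t , t<m , jt , ¬jt) = switch J? j₂ (<⇒≤ 3≤m) (I⇒¬J (I-periodic 0 i₀))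
          (d₁ , d₂) = far (s≤s 2≤t) t<m
      in inj₁ (vertex 1 , vertex 2 , vertex (suc t) , vertex t ,
               j₁ , (_ , reverse i₀) , reverse jt , (_ , ¬J⇒I ¬jt) , d₁ , d₂)
    ... | no ¬j₂ with anyUpTo? (λ t → (2 ≤? t) ×-dec J? t) m
    ...   | yes (b , b<m , 2≤b , jb) =
      let (t , 2≤t , t<b , it , ¬it) = switch I? (¬J⇒I ¬j₂) 2≤b (λ p → I⇒¬J p jb)
          (d₁ , d₂) = far (s≤s 2≤t) (≤-trans t<b (<⇒≤ b<m))
      in inj₁ (vertex 1 , vertex 2 , vertex (suc t) , vertex (suc (suc t)) ,
               j₁ , (_ , reverse i₀) , ¬I⇒J ¬it , (_ , reverse it) , d₁ , d₂)
    ...   | no ∄ = inj₂ (vertex 1 , vertex 2 , j₁ ,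
                 (vertex 0 , reverse i₀ , before 3≤m refl) ,
                 (vertex 3 , ¬J⇒I ¬j₂ , vertex 4 , distinct (s≤s (s≤s (s≤s z≤n))) (+-monoˡ-≤ 2 3≤m) ∘ sym , i₃))
      where
      i-inner : ∀ {t} → 2 ≤ t → t < m → I t
      i-inner 2≤t t<m = ¬J⇒I λ p → ∄ (_ , t<m , 2≤t , p)
      -- For `m` = 3, step 3 is step 0 again.
      i₃ : I 3
      i₃ with m≤n⇒m<n∨m≡n 3≤m
      ... | inj₁ lt = i-inner (s≤s (s≤s z≤n)) lt
      ... | inj₂ e  = subst I (sym e) (I-periodic 0 i₀)
      before : ∀ {l} → 3 ≤ l → l ≡ m → ∃ λ w → w ≢ vertex 1 × ColorClass col i (vertex 0) w
      before (s≤s {n = l} 2≤l) e = vertex l ,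
          distinct 2≤l (≤-trans (≤-reflexive e) (m≤m+n m 1)) ∘ sym ,
          reverse (subst (ColorClass col i (vertex l)) (trans (cong vertex e) (vertex-m+ 0)) (i-inner 2≤l (≤-reflexive e)))

  union-cycle : ¬ HasCycle (ColorClass col i) → ¬ HasCycle (ColorClass col j) →
                HasCycle (ColorClass₂ col i j) → TwoEdges ⊎ InnerEdge
  union-cycle ¬ci ¬cj cyc =
    let C = periodicCycle cyc
        open PeriodicCycle C using (vertex)
        (t , it , jt) = Walk.start C ¬ci ¬cj
    in Walk.from-start (shift t C)
         (subst₂ (λ r s → ColorClass col i (vertex r) (vertex s)) (+-comm 0 t) (+-comm 1 t) it)
         (subst₂ (λ r s → ColorClass col j (vertex r) (vertex s)) (+-comm 1 t) (+-comm 2 t) jt)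

-- Counting

sum-mono : ∀ {n} {f g : Fin n → ℕ} → (∀ x → f x ≤ g x) → sum f ≤ sum g
sum-mono {zero}  _  = z≤n
sum-mono {suc n} le = +-mono-≤ (le zero) (sum-mono (le ∘ suc))

sum-const : ∀ n c → sum {n} (λ _ → c) ≡ n * c
sum-const zero    c = refl
sum-const (suc n) c = cong (c +_) (sum-const n c)

term≤sum : ∀ {n} (f : Fin n → ℕ) x → f x ≤ sum f
term≤sum f zero    = m≤m+n _ _
term≤sum f (suc x) = ≤-trans (term≤sum (f ∘ suc) x) (m≤n+m _ _)

sum-punch : ∀ {n} (f : Fin (suc n) → ℕ) x → sum f ≡ f x + sum (f ∘ punchIn x)
sum-punch f x = sum-remove {i = x} f

two-terms≤sum : ∀ {n} (f : Fin n → ℕ) {x y} → x ≢ y → f x + f y ≤ sum f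
two-terms≤sum {suc n} f {x} {y} x≢y = subst (f x + f y ≤_) (sym (sum-punch f x)) (+-monoʳ-≤ (f x)
  (subst (λ z → f z ≤ sum (f ∘ punchIn x)) (Finₚ.punchIn-punchOut x≢y) (term≤sum (f ∘ punchIn x) (punchOut x≢y))))

sum-min : ∀ {K} (f : Fin (suc K) → ℕ) → ∃ λ i → suc K * f i ≤ sum f
sum-min {zero}  f = zero , ≤-refl
sum-min {suc K} f with sum-min (f ∘ suc)
... | i , le with ≤-total (f zero) (f (suc i))
... | inj₁ p = zero , +-monoʳ-≤ (f zero) (≤-trans (*-monoʳ-≤ (suc K) p) le)
... | inj₂ p = suc i , +-mono-≤ p le

-- Runs over ordered pairs, so each edge counts twice: `degSum` is twice the number of edges, and
-- edges of total weight 2 give a `load` of 4.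
sum² : ∀ {n} → (Fin n → Fin n → ℕ) → ℕ
sum² f = sum λ x → sum (f x)

sum²-mono : ∀ {n} {f g : Fin n → Fin n → ℕ} → (∀ x y → f x y ≤ g x y) → sum² f ≤ sum² g
sum²-mono le = sum-mono λ x → sum-mono (le x)

sum²-cong : ∀ {n} {f g : Fin n → Fin n → ℕ} → (∀ x y → f x y ≡ g x y) → sum² f ≡ sum² g
sum²-cong e = sum-cong-≗ λ x → sum-cong-≗ (e x)

sum²-+ : ∀ {n} (f g : Fin n → Fin n → ℕ) → sum² (λ x y → f x y + g x y) ≡ sum² f + sum² g
sum²-+ f g = trans (sum-cong-≗ λ x → ∑-distrib-+ (f x) (g x)) (∑-distrib-+ (sum ∘ f) (sum ∘ g))

sum²-* : ∀ {n} (f g : Fin n → ℕ) → sum² (λ x y → f x * g y) ≡ sum f * sum g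
sum²-* f g = trans (sum-cong-≗ λ x → sym (*-distribˡ-sum (f x) g)) (sym (*-distribʳ-sum (sum g) f))

∑-sum² : ∀ {k n} (f : Fin k → Fin n → Fin n → ℕ) → sum (λ c → sum² (f c)) ≡ sum² (λ x y → sum λ c → f c x y)
∑-sum² f = trans (∑-comm (λ c x → sum (f c x))) (sum-cong-≗ λ x → ∑-comm (λ c y → f c x y))

𝟙 : {P : Set} → Dec P → ℕ
𝟙 (yes _) = 1
𝟙 (no _)  = 0

𝟙-yes : {P : Set} (P? : Dec P) → P → 𝟙 P? ≡ 1
𝟙-yes (yes _) _ = refl
𝟙-yes (no ¬p) p = ⊥-elim (¬p p)

𝟙≤1 : {P : Set} (P? : Dec P) → 𝟙 P? ≤ 1
𝟙≤1 (yes _) = ≤-refl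
𝟙≤1 (no _)  = z≤n

𝟙-≤ : {P : Set} (P? : Dec P) {m : ℕ} → (P → 1 ≤ m) → 𝟙 P? ≤ m
𝟙-≤ (yes p) f = f p
𝟙-≤ (no _)  _ = z≤n

𝟙-cong : {P Q : Set} (P? : Dec P) (Q? : Dec Q) → (P → Q) → (Q → P) → 𝟙 P? ≡ 𝟙 Q?
𝟙-cong (yes _) (yes _) _ _ = refl
𝟙-cong (yes p) (no ¬q) f _ = ⊥-elim (¬q (f p))
𝟙-cong (no ¬p) (yes q) _ g = ⊥-elim (¬p (g q))
𝟙-cong (no _)  (no _)  _ _ = refl

sum-𝟙-unique : ∀ {n} {P : Fin n → Set} (P? : ∀ x → Dec (P x)) → (∀ {x y} → P x → P y → x ≡ y) → sum (λ x → 𝟙 (P? x)) ≤ 1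
sum-𝟙-unique {zero}  P? uniq = z≤n
sum-𝟙-unique {suc n} P? uniq with P? zero
... | no _  = sum-𝟙-unique (P? ∘ suc) (λ p q → Finₚ.suc-injective (uniq p q))
... | yes p = s≤s (≤-trans (sum-mono {g = λ _ → 0} λ x → 𝟙-≤ (P? (suc x)) λ q → ⊥-elim (Finₚ.0≢1+n (uniq p q)))
                           (≤-reflexive (trans (sum-const n 0) (*-zeroʳ n))))

sum-≢ : ∀ {n} (x : Fin (suc n)) → sum (λ y → 𝟙 (¬? (x Finₚ.≟ y))) ≤ n
sum-≢ {n} x = begin
  sum f                       ≡⟨ sum-punch f x ⟩
  f x + sum (f ∘ punchIn x)   ≤⟨ +-mono-≤ (𝟙-≤ (¬? (x Finₚ.≟ x)) λ x≢x → ⊥-elim (x≢x refl)) (sum-mono λ y → 𝟙≤1 (¬? (x Finₚ.≟ punchIn x y))) ⟩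
  sum {n} (λ _ → 1)           ≡⟨ trans (sum-const n 1) (*-identityʳ n) ⟩
  n                           ∎
  where
  open ≤-Reasoning
  f = λ y → 𝟙 (¬? (x Finₚ.≟ y))

-- The sum is compared with `h`, a sum of point masses of height `c` at the listed pairs;
-- distinctness leaves at most one mass at each place.
sum²-unique : ∀ {n} {f : Fin n → Fin n → ℕ} c {zs : List (Fin n × Fin n)} → Unique zs →
              All (λ z → c ≤ f (proj₁ z) (proj₂ z)) zs → length zs * c ≤ sum² f
sum²-unique {n} {f} c {zs} uniq large = ≤-trans (total zs) (sum²-mono λ x y → below x y uniq large)
  where
  δ : Fin n × Fin n → Fin n → Fin n → ℕ
  δ z x y = 𝟙 (≡-dec Finₚ._≟_ Finₚ._≟_ z (x , y)) * c
  h : List (Fin n × Fin n) → Fin n → Fin n → ℕ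
  h []       x y = 0
  h (z ∷ zs) x y = δ z x y + h zs x y
  total : ∀ zs → length zs * c ≤ sum² (h zs)
  total []       = z≤n
  total (z@(x , y) ∷ zs) = begin
    c + length zs * c        ≡⟨ cong (_+ length zs * c) (trans (sym (*-identityˡ c)) (cong (_* c) (sym (𝟙-yes (≡-dec Finₚ._≟_ Finₚ._≟_ z z) refl)))) ⟩
    δ z x y + length zs * c  ≤⟨ +-mono-≤ (≤-trans (term≤sum (δ z x) y) (term≤sum (sum ∘ δ z) x)) (total zs) ⟩
    sum² (δ z) + sum² (h zs) ≡⟨ sym (sum²-+ (δ z) (h zs)) ⟩
    sum² (h (z ∷ zs))        ∎
    where open ≤-Reasoning
  absent : ∀ x y {zs} → All (λ z → (x , y) ≢ z) zs → h zs x y ≡ 0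
  absent x y []                     = refl
  absent x y (_∷_ {x = z} ≢z rest) with ≡-dec Finₚ._≟_ Finₚ._≟_ z (x , y)
  ... | yes e = ⊥-elim (≢z (sym e))
  ... | no _  = absent x y rest
  below : ∀ x y {zs} → Unique zs → All (λ z → c ≤ f (proj₁ z) (proj₂ z)) zs → h zs x y ≤ f x y
  below x y []                     []       = z≤n
  below x y (_∷_ {x = z} ∉ uniq) (l ∷ ls) with ≡-dec Finₚ._≟_ Finₚ._≟_ z (x , y)
  ... | no _     = below x y uniq ls
  ... | yes refl = ≤-trans (≤-reflexive (trans (cong (c + 0 +_) (absent x y ∉)) (trans (+-identityʳ _) (+-identityʳ c)))) l

-- Weighing the edges relative to a fixed colour

module Count {n k : ℕ} (col : EdgeColoring n k) (col-sym : ∀ u v → col u v ≡ col v u) where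

  e : Fin k → Fin n → Fin n → ℕ
  e c x y = 𝟙 (colorClass? col c x y)

  e-comm : ∀ c x y → e c x y ≡ e c y x
  e-comm c x y = 𝟙-cong (colorClass? col c x y) (colorClass? col c y x) (flip x y) (flip y x)
    where
    flip : ∀ x y → ColorClass col c x y → ColorClass col c y x
    flip x y (d , p) = d ∘ sym , trans (col-sym y x) p

  ∑-e : ∀ x y → sum (λ c → e c x y) ≤ 𝟙 (¬? (x Finₚ.≟ y))
  ∑-e x y = bound (x Finₚ.≟ y)
    where
    bound : (d : Dec (x ≡ y)) → sum (λ c → e c x y) ≤ 𝟙 (¬? d)
    bound (no _)    = sum-𝟙-unique (λ c → colorClass? col c x y) λ { (_ , p) (_ , q) → trans (sym p) q }
    bound (yes x≡y) = ≤-trans (sum-mono {g = λ _ → 0} λ c → 𝟙-≤ (colorClass? col c x y) λ { (x≢y , _) → ⊥-elim (x≢y x≡y) })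
                              (≤-reflexive (trans (sum-const k 0) (*-zeroʳ k)))

  deg : Fin k → Fin n → ℕ
  deg c x = sum (e c x)

  degSum : Fin k → ℕ
  degSum c = sum² (e c)

  module Fixed (i : Fin k) where

    deep? : ∀ x → Dec (∃ λ y → ColorClass col i x y × 2 ≤ deg i y)
    deep? x = any? λ y → colorClass? col i x y ×-dec (2 ≤? deg i y)

    -- `a` and `b` are the characteristic functions of the covered and of the deep vertices; `V` and
    -- `V′` below are the sizes of these sets.
    a b h : Fin n → ℕ
    a x = 𝟙 (1 ≤? deg i x)
    b x = 𝟙 (deep? x)
    h x = 𝟙 (2 ≤? deg i x)

    V V′ : ℕ
    V  = sum a
    V′ = sum b

    1≤deg : ∀ {x y} → ColorClass col i x y → 1 ≤ deg i x
    1≤deg {x} {y} xy = subst (_≤ deg i x) (𝟙-yes (colorClass? col i x y) xy) (term≤sum (e i x) y)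

    2≤deg : ∀ {x y z} → y ≢ z → ColorClass col i x y → ColorClass col i x z → 2 ≤ deg i x
    2≤deg {x} {y} {z} y≢z xy xz = ≤-trans
      (≤-reflexive (sym (cong₂ _+_ (𝟙-yes (colorClass? col i x y) xy) (𝟙-yes (colorClass? col i x z) xz))))
      (two-terms≤sum (e i x) y≢z)

    V≤n : V ≤ n
    V≤n = ≤-trans (sum-mono λ x → 𝟙≤1 (1 ≤? deg i x)) (≤-reflexive (trans (sum-const n 1) (*-identityʳ n)))

    V′≤V : V′ ≤ V
    V′≤V = sum-mono λ x → 𝟙-≤ (deep? x) λ { (y , xy , _) → ≤-reflexive (sym (𝟙-yes (1 ≤? deg i x) (1≤deg xy))) }

    b≤ : ∀ x → b x ≤ sum (λ y → e i x y * h y)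
    b≤ x = 𝟙-≤ (deep? x) λ { (y , xy , d) → ≤-trans
      (≤-reflexive (sym (cong₂ _*_ (𝟙-yes (colorClass? col i x y) xy) (𝟙-yes (2 ≤? deg i y) d))))
      (term≤sum (λ y → e i x y * h y) y) }

    -- Every deep vertex is adjacent to some `y` of degree at least 2, and such a `y` has only
    -- `deg i y` neighbours.
    V′≤∑ : V′ ≤ sum (λ y → deg i y * h y)
    V′≤∑ = ≤-trans (sum-mono b≤) (≤-reflexive (trans (∑-comm (λ x y → e i x y * h y))
      (sum-cong-≗ λ y → trans (sum-cong-≗ λ x → cong (_* h y) (e-comm i x y)) (sym (*-distribʳ-sum (h y) (e i y))))))

    -- Degree 1 gives 0 + 2, and degree `d` at least 2 gives `d` + 2, which is at most 2`d`.
    pointwise : ∀ y → deg i y * h y + 2 * a y ≤ 2 * deg i y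
    pointwise y = split (deg i y) (2 ≤? deg i y) (1 ≤? deg i y)
      where
      split : ∀ d (p : Dec (2 ≤ d)) (q : Dec (1 ≤ d)) → d * 𝟙 p + 2 * 𝟙 q ≤ 2 * d
      split d (no _)  (no _)  = ≤-trans (≤-reflexive (trans (+-identityʳ _) (*-zeroʳ d))) z≤n
      split d (no _)  (yes q) = ≤-trans (≤-reflexive (cong (_+ 2) (*-zeroʳ d))) (*-monoʳ-≤ 2 q)
      split d (yes p) q       = begin
        d * 1 + 2 * 𝟙 q ≤⟨ +-mono-≤ (≤-reflexive (*-identityʳ d)) (≤-trans (*-monoʳ-≤ 2 (𝟙≤1 q)) p) ⟩
        d + d           ≡⟨ cong (d +_) (sym (+-identityʳ d)) ⟩
        2 * d           ∎
        where open ≤-Reasoning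

    V′+2V≤2D : V′ + 2 * V ≤ 2 * degSum i
    V′+2V≤2D = begin
      V′ + 2 * V                              ≤⟨ +-mono-≤ V′≤∑ (≤-reflexive (*-distribˡ-sum 2 a)) ⟩
      sum (λ y → deg i y * h y) + sum (λ y → 2 * a y) ≡⟨ sym (∑-distrib-+ (λ y → deg i y * h y) (λ y → 2 * a y)) ⟩
      sum (λ y → deg i y * h y + 2 * a y)     ≤⟨ sum-mono pointwise ⟩
      sum (λ y → 2 * deg i y)                 ≡⟨ sym (*-distribˡ-sum 2 (deg i)) ⟩
      2 * degSum i                            ∎
      where open ≤-Reasoning

    -- An edge counts once if it meets V, and once more if it lies inside V′.
    weight : Fin n → Fin n → ℕ
    weight x y = (a x ⊔ a y) + b x * b y

    -- For values 0 and 1, maximum plus product is the sum. Adding `V * V` therefore turns the count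
    -- of ordered pairs meeting the covered set into 2`n` times `V`.
    ∑-weight : sum² weight + V * V ≡ 2 * n * V + V′ * V′
    ∑-weight = begin
      sum² weight + V * V
        ≡⟨ cong₂ _+_ (sum²-+ (λ x y → a x ⊔ a y) (λ x y → b x * b y)) (sym (sum²-* a a)) ⟩
      sum² (λ x y → a x ⊔ a y) + sum² (λ x y → b x * b y) + sum² (λ x y → a x * a y)
        ≡⟨ swap₃ (sum² (λ x y → a x ⊔ a y)) _ _ ⟩
      sum² (λ x y → a x ⊔ a y) + sum² (λ x y → a x * a y) + sum² (λ x y → b x * b y)
        ≡⟨ cong₂ _+_ (trans (sym (sum²-+ (λ x y → a x ⊔ a y) (λ x y → a x * a y))) (sum²-cong incl-excl)) (sum²-* b b) ⟩
      sum² (λ x y → a x + a y) + V′ * V′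
        ≡⟨ cong (_+ V′ * V′) (trans (sum²-+ (λ x _ → a x) (λ _ y → a y)) (cong₂ _+_ rows cols)) ⟩
      n * V + n * V + V′ * V′
        ≡⟨ cong (_+ V′ * V′) (double n V) ⟩
      2 * n * V + V′ * V′ ∎
      where
      open ≡-Reasoning
      swap₃ : ∀ x y z → x + y + z ≡ x + z + y
      swap₃ = solve-∀
      double : ∀ x y → x * y + x * y ≡ 2 * x * y
      double = solve-∀
      rows : sum² {n} (λ x _ → a x) ≡ n * V
      rows = trans (sum-cong-≗ λ x → sum-const n (a x)) (sym (*-distribˡ-sum n a))
      cols : sum² {n} (λ _ y → a y) ≡ n * V
      cols = sum-const n V
      bits : ∀ {p q} → p ≤ 1 → q ≤ 1 → (p ⊔ q) + p * q ≡ p + q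
      bits z≤n             z≤n             = refl
      bits z≤n             (s≤s z≤n)       = refl
      bits (s≤s z≤n)       z≤n             = refl
      bits (s≤s z≤n)       (s≤s z≤n)       = refl
      incl-excl : ∀ x y → (a x ⊔ a y) + a x * a y ≡ a x + a y
      incl-excl x y = bits (𝟙≤1 (1 ≤? deg i x)) (𝟙≤1 (1 ≤? deg i y))

    load : Fin k → ℕ
    load j = sum² λ x y → e j x y * weight x y

    -- An ordered pair lies in at most one class, so the colours share the weight out among
    -- themselves. Diagonal pairs carry no load and only weaken the bound.
    ∑-load : sum load ≤ sum² weight
    ∑-load = ≤-trans (≤-reflexive (∑-sum² λ j x y → e j x y * weight x y)) (sum²-mono λ x y → begin
      sum (λ j → e j x y * weight x y)   ≡⟨ sym (*-distribʳ-sum (weight x y) (λ j → e j x y)) ⟩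
      sum (λ j → e j x y) * weight x y   ≤⟨ *-monoˡ-≤ (weight x y) (≤-trans (∑-e x y) (𝟙≤1 (¬? (x Finₚ.≟ y)))) ⟩
      1 * weight x y                     ≡⟨ *-identityˡ _ ⟩
      weight x y                         ∎)
      where open ≤-Reasoning

    module _ {j : Fin k} (i≢j : i ≢ j) where
      open Union col col-sym i≢j

      deep⇒b : ∀ {u} → Deep u → b u ≡ 1
      deep⇒b {u} (v , uv , w , w≢u , vw) = 𝟙-yes (deep? u) (v , uv , 2≤deg (w≢u ∘ sym) (reverse uv) vw)

      deep⇒covered : ∀ {u} → Deep u → Covered u
      deep⇒covered (v , uv , _) = v , uv

      covered⇒a : ∀ {u} → Covered u → a u ≡ 1
      covered⇒a {u} (v , uv) = 𝟙-yes (1 ≤? deg i u) (1≤deg uv)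

      weighted : ∀ {u v} c → ColorClass col j u v → c ≤ weight u v → c ≤ e j u v * weight u v
      weighted {u} {v} c uv le = subst (λ z → c ≤ z * weight u v) (sym (𝟙-yes (colorClass? col j u v) uv))
        (≤-trans le (≤-reflexive (sym (*-identityˡ _))))

      covered-weightˡ : ∀ {u} v → Covered u → 1 ≤ weight u v
      covered-weightˡ {u} v cu = ≤-trans (subst (_≤ a u ⊔ a v) (covered⇒a cu) (m≤m⊔n (a u) (a v))) (m≤m+n _ _)

      covered-weightʳ : ∀ {u} v → Covered u → 1 ≤ weight v u
      covered-weightʳ {u} v cu = ≤-trans (subst (_≤ a v ⊔ a u) (covered⇒a cu) (m≤n⊔m (a v) (a u))) (m≤m+n _ _)

      deep-weight : ∀ {u v} → Deep u → Deep v → 2 ≤ weight u v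
      deep-weight {u} {v} du dv = +-mono-≤ {1} (subst (_≤ a u ⊔ a v) (covered⇒a (deep⇒covered du)) (m≤m⊔n (a u) (a v)))
        (≤-reflexive (sym (cong₂ _*_ (deep⇒b du) (deep⇒b dv))))

      -- Two edges give four ordered pairs of weight at least 1, an inner edge two ordered pairs of
      -- weight at least 2.
      4≤load : TwoEdges ⊎ InnerEdge → 4 ≤ load j
      4≤load (inj₁ (u , v , u′ , v′ , uv , cu , uv′ , cu′ , u≢u′ , v≢u′)) =
        sum²-unique 1 {(u , v) ∷ (v , u) ∷ (u′ , v′) ∷ (v′ , u′) ∷ []}
          (((proj₁ uv ∘ cong proj₁) ∷ (u≢u′ ∘ cong proj₁) ∷ (v≢u′ ∘ cong proj₂) ∷ [])
          ∷ ((v≢u′ ∘ cong proj₁) ∷ (u≢u′ ∘ cong proj₂) ∷ [])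
          ∷ ((proj₁ uv′ ∘ cong proj₁) ∷ [])
          ∷ [] ∷ [])
          (weighted 1 uv (covered-weightˡ v cu) ∷ weighted 1 (reverse uv) (covered-weightʳ v cu)
          ∷ weighted 1 uv′ (covered-weightˡ v′ cu′) ∷ weighted 1 (reverse uv′) (covered-weightʳ v′ cu′) ∷ [])
      4≤load (inj₂ (u , v , uv , du , dv)) =
        sum²-unique 2 {(u , v) ∷ (v , u) ∷ []}
          (((proj₁ uv ∘ cong proj₁) ∷ []) ∷ [] ∷ [])
          (weighted 2 uv (deep-weight du dv) ∷ weighted 2 (reverse uv) (deep-weight dv du) ∷ [])

∑-degSum : ∀ {n k} (col : EdgeColoring (suc n) k) (col-sym : ∀ u v → col u v ≡ col v u) →
           sum (Count.degSum col col-sym) ≤ suc n * n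
∑-degSum {n} col col-sym = begin
  sum degSum                                ≡⟨ ∑-sum² e ⟩
  sum² (λ x y → sum λ c → e c x y)          ≤⟨ sum²-mono {g = λ x y → 𝟙 (¬? (x Finₚ.≟ y))} ∑-e ⟩
  sum² {suc n} (λ x y → 𝟙 (¬? (x Finₚ.≟ y)))        ≤⟨ sum-mono {suc n} {g = λ _ → n} sum-≢ ⟩
  sum {suc n} (λ _ → n)                     ≡⟨ sum-const (suc n) n ⟩
  suc n * n                                 ∎
  where
  open Count col col-sym
  open ≤-Reasoning

counting-bound : ∀ {n K} (col : EdgeColoring n (suc K)) → ((col-sym , _) : IsAchromaticArbColoring n (suc K) col) → ∀ i →
                 let open Count.Fixed col col-sym i in 4 * K + V * V ≤ 2 * n * V + V′ * V′
counting-bound {n} {K} col (col-sym , _ , acyc , cyc) i = begin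
  4 * K + V * V            ≤⟨ +-monoˡ-≤ (V * V) 4K≤ ⟩
  sum² weight + V * V      ≡⟨ ∑-weight ⟩
  2 * n * V + V′ * V′      ∎
  where
  open Count col col-sym
  open Fixed i
  open ≤-Reasoning
  4K≤ : 4 * K ≤ sum² weight
  4K≤ = begin
    4 * K                                   ≡⟨ trans (*-comm 4 K) (sym (sum-const K 4)) ⟩
    sum {K} (λ _ → 4)                       ≤⟨ sum-mono (λ x → let i≢j = Finₚ.punchInᵢ≢i i x ∘ sym in
                                                 4≤load i≢j (Union.union-cycle col col-sym i≢j (acyc i) (acyc _) (cyc i _ i≢j))) ⟩
    sum (load ∘ punchIn i)                  ≤⟨ m≤n+m _ (load i) ⟩
    load i + sum (load ∘ punchIn i)         ≡⟨ sym (sum-punch load i) ⟩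
    sum load                                ≤⟨ ∑-load ⟩
    sum² weight                             ∎

-- The upper bound

module UpperArithmetic {n K D V V′ : ℕ} (Dk≤ : suc K * D ≤ suc n * n) (V≤n : V ≤ suc n) (V′≤V : V′ ≤ V)
                       (V′+2V≤2D : V′ + 2 * V ≤ 2 * D) (count : 4 * K + V * V ≤ 2 * suc n * V + V′ * V′)
                       (K≤n² : K ≤ suc n * suc n) where
  open ≤-Reasoning

  N = suc n
  k = suc K

  4K+V²≤2ND : 4 * K + V * V ≤ 2 * N * D
  4K+V²≤2ND = begin
    4 * K + V * V            ≤⟨ count ⟩
    2 * N * V + V′ * V′      ≤⟨ +-monoʳ-≤ (2 * N * V) (*-monoʳ-≤ V′ (≤-trans V′≤V V≤n)) ⟩
    2 * N * V + V′ * N       ≡⟨ rearrange N V V′ ⟩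
    N * (V′ + 2 * V)         ≤⟨ *-monoʳ-≤ N V′+2V≤2D ⟩
    N * (2 * D)              ≡⟨ assoc₂ N D ⟩
    2 * N * D                ∎
    where
    rearrange : ∀ N V V′ → 2 * N * V + V′ * N ≡ N * (V′ + 2 * V)
    rearrange = solve-∀
    assoc₂ : ∀ N D → N * (2 * D) ≡ 2 * N * D
    assoc₂ = solve-∀

  -- Replacing `V` by `D`/2 gives 16`K` ≤ `D`(8`N` - `D`). Multiplied by `k`, with `k * D` ≤
  -- `N * n`, this is `first`; its loss of `N * n * D` is exactly what `second` may use up.
  dense : D ≤ 2 * V → 16 * (K * k) + 2 * (K * n) ≤ 8 * (N * N * n)
  dense D≤2V = begin
    16 * (K * k) + 2 * (K * n)                   ≤⟨ +-mono-≤ first second ⟩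
    N * n * (8 * N ∸ D) + N * n * D              ≡⟨ sym (*-distribˡ-+ (N * n) (8 * N ∸ D) D) ⟩
    N * n * ((8 * N ∸ D) + D)                    ≡⟨ cong (N * n *_) (m∸n+n≡m (D≤8N D 16K+D²≤8ND)) ⟩
    N * n * (8 * N)                              ≡⟨ tidy N n ⟩
    8 * (N * N * n)                              ∎
    where
    tidy : ∀ N n → N * n * (8 * N) ≡ 8 * (N * N * n)
    tidy = solve-∀
    16K+D²≤8ND : 16 * K + D * D ≤ D * (8 * N)
    16K+D²≤8ND = begin
      16 * K + D * D               ≤⟨ +-monoʳ-≤ (16 * K) (*-mono-≤ D≤2V D≤2V) ⟩
      16 * K + (2 * V) * (2 * V)   ≡⟨ e₁ K V ⟩
      4 * (4 * K + V * V)          ≤⟨ *-monoʳ-≤ 4 4K+V²≤2ND ⟩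
      4 * (2 * N * D)              ≡⟨ e₂ N D ⟩
      D * (8 * N)                  ∎
      where
      e₁ : ∀ K V → 16 * K + (2 * V) * (2 * V) ≡ 4 * (4 * K + V * V)
      e₁ = solve-∀
      e₂ : ∀ N D → 4 * (2 * N * D) ≡ D * (8 * N)
      e₂ = solve-∀
    -- Makes the truncated subtraction `8 * N ∸ D` exact.
    D≤8N : ∀ D → 16 * K + D * D ≤ D * (8 * N) → D ≤ 8 * N
    D≤8N zero      _  = z≤n
    D≤8N D@(suc _) le = *-cancelˡ-≤ D (m+n≤o⇒n≤o (16 * K) le)
    16K≤ : 16 * K ≤ D * (8 * N ∸ D)
    16K≤ = begin
      16 * K                 ≤⟨ m+n≤o⇒m≤o∸n (16 * K) 16K+D²≤8ND ⟩
      D * (8 * N) ∸ D * D    ≡⟨ sym (*-distribˡ-∸ D (8 * N) D) ⟩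
      D * (8 * N ∸ D)        ∎
    first : 16 * (K * k) ≤ N * n * (8 * N ∸ D)
    first = begin
      16 * (K * k)               ≡⟨ f₁ K k ⟩
      k * (16 * K)               ≤⟨ *-monoʳ-≤ k 16K≤ ⟩
      k * (D * (8 * N ∸ D))      ≡⟨ sym (*-assoc k D _) ⟩
      k * D * (8 * N ∸ D)        ≤⟨ *-monoˡ-≤ (8 * N ∸ D) Dk≤ ⟩
      N * n * (8 * N ∸ D)        ∎
      where
      f₁ : ∀ K k → 16 * (K * k) ≡ k * (16 * K)
      f₁ = solve-∀
    second : 2 * (K * n) ≤ N * n * D
    second = begin
      2 * (K * n)    ≡⟨ sym (*-assoc 2 K n) ⟩
      2 * K * n      ≤⟨ *-monoˡ-≤ n (*-cancelˡ-≤ {2 * K} {N * D} 2 (begin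
                          2 * (2 * K)      ≡⟨ sym (*-assoc 2 2 K) ⟩
                          4 * K            ≤⟨ m+n≤o⇒m≤o (4 * K) 4K+V²≤2ND ⟩
                          2 * N * D        ≡⟨ *-assoc 2 N D ⟩
                          2 * (N * D)      ∎)) ⟩
      N * D * n      ≡⟨ s₁ N D n ⟩
      N * n * D      ∎
      where
      s₁ : ∀ N D n → N * D * n ≡ N * n * D
      s₁ = solve-∀

  -- Here `V′` ≤ `V` cancels the squares and leaves 4`K` ≤ 2`N` `V` ≤ `N` `D`. The leading term is
  -- thereby halved, so the trivial bound on `K` suffices for the linear term.
  sparse : 2 * V ≤ D → 16 * (K * k) + 2 * (K * n) ≤ 8 * (N * N * n)
  sparse 2V≤D = begin
    16 * (K * k) + 2 * (K * n)               ≡⟨ cong (_+ 2 * (K * n)) (f₁ K k) ⟩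
    4 * (k * (4 * K)) + 2 * (K * n)          ≤⟨ +-mono-≤ (*-monoʳ-≤ 4 (*-monoʳ-≤ k 4K≤ND)) (*-monoʳ-≤ 2 (*-monoˡ-≤ n K≤n²)) ⟩
    4 * (k * (N * D)) + 2 * (N * N * n)      ≡⟨ cong (_+ 2 * (N * N * n)) (f₂ k N D) ⟩
    4 * (N * (k * D)) + 2 * (N * N * n)      ≤⟨ +-monoˡ-≤ (2 * (N * N * n)) (*-monoʳ-≤ 4 (*-monoʳ-≤ N Dk≤)) ⟩
    4 * (N * (N * n)) + 2 * (N * N * n)      ≡⟨ f₃ N n ⟩
    6 * (N * N * n)                          ≤⟨ *-monoˡ-≤ (N * N * n) (s≤s (s≤s (s≤s (s≤s (s≤s (s≤s (z≤n {2}))))))) ⟩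
    8 * (N * N * n)                          ∎
    where
    f₁ : ∀ K k → 16 * (K * k) ≡ 4 * (k * (4 * K))
    f₁ = solve-∀
    f₂ : ∀ k N D → 4 * (k * (N * D)) ≡ 4 * (N * (k * D))
    f₂ = solve-∀
    f₃ : ∀ N n → 4 * (N * (N * n)) + 2 * (N * N * n) ≡ 6 * (N * N * n)
    f₃ = solve-∀
    4K≤ND : 4 * K ≤ N * D
    4K≤ND = begin
      4 * K          ≤⟨ +-cancelʳ-≤ (V * V) (4 * K) (2 * N * V) (≤-trans count (+-monoʳ-≤ (2 * N * V) (*-mono-≤ V′≤V V′≤V))) ⟩
      2 * N * V      ≡⟨ g₁ N V ⟩
      N * (2 * V)    ≤⟨ *-monoʳ-≤ N 2V≤D ⟩
      N * D          ∎
      where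
      g₁ : ∀ N V → 2 * N * V ≡ N * (2 * V)
      g₁ = solve-∀

  bound : 8 * (K * k) + K * n ≤ 4 * (N * N * n)
  bound = *-cancelˡ-≤ 2 (begin
    2 * (8 * (K * k) + K * n)      ≡⟨ g₁ K k n ⟩
    16 * (K * k) + 2 * (K * n)     ≤⟨ [ dense , sparse ]′ (≤-total D (2 * V)) ⟩
    8 * (N * N * n)                ≡⟨ *-assoc 2 4 (N * N * n) ⟩
    2 * (4 * (N * N * n))          ∎)
    where
    g₁ : ∀ K k n → 2 * (8 * (K * k) + K * n) ≡ 16 * (K * k) + 2 * (K * n)
    g₁ = solve-∀

quadratic-bound : ∀ {n K} → HasAchromaticArbColoring (suc n) (suc K) →
                  8 * (K * suc K) + K * n ≤ 4 * (suc n * suc n * n)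
quadratic-bound {n} {K} has@(col , ok@(col-sym , _)) =
  UpperArithmetic.bound (≤-trans min (∑-degSum col col-sym)) V≤n V′≤V V′+2V≤2D (counting-bound col ok i)
    (≤-trans (n≤1+n K) (hasAchromaticArbColoring⇒≤ has))
  where
  open Count col col-sym
  i = proj₁ (sum-min degSum)
  min = proj₂ (sum-min degSum)
  open Fixed i

-- The factor 676 is 52²/4: it turns the right side of the quadratic bound into 52² `N`² `n`, and
-- 2704 `N`² = 52² `N`² completes `n` to `N`.
upper-arithmetic : ∀ x N K n slack → 2 * (x * x) + slack ≡ 676 * (8 * (K * suc K) + K * n) + 2704 * (N * N) → N ≡ suc n →
                   8 * (K * suc K) + K * n ≤ 4 * (N * N * n) → 2 * x ^ 2 ≤ 52 ^ 2 * N ^ 3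
upper-arithmetic x N K n slack expand N≡ le = begin
  2 * x ^ 2                                             ≡⟨ cong (λ z → 2 * (x * z)) (*-identityʳ x) ⟩
  2 * (x * x)                                           ≤⟨ m≤m+n _ slack ⟩
  2 * (x * x) + slack                                   ≡⟨ expand ⟩
  676 * (8 * (K * suc K) + K * n) + 2704 * (N * N)      ≤⟨ +-monoˡ-≤ (2704 * (N * N)) (*-monoʳ-≤ 676 le) ⟩
  676 * (4 * (N * N * n)) + 2704 * (N * N)              ≡⟨ collect N n ⟩
  2704 * (N * N * (1 + n))                              ≡⟨ cong (λ z → 2704 * (N * N * z)) (sym N≡) ⟩
  2704 * (N * N * N)                                    ≡⟨ cong (2704 *_) (trans (*-assoc N N N) (cong (λ z → N * (N * z)) (sym (*-identityʳ N)))) ⟩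
  52 ^ 2 * N ^ 3                                        ∎
  where
  open ≤-Reasoning
  collect : ∀ N n → 676 * (4 * (N * N * n)) + 2704 * (N * N) ≡ 2704 * (N * N * (1 + n))
  collect = solve-∀

-- The difference of the two sides of upper-expansion at n = 12 + r; the terms in K alone cancel there,
-- which is what determines the constant 52.
slack : ℕ → ℕ → ℕ
slack K r = 468 * (K * r) + (2702 * (r * r) + 70044 * r + 448526)

-- With `d` in place of 52 and `r` = 0, the coefficients of `K` are 4`d`(`d` + 13) on the left and
-- 5`d`² on the right; they agree for `d` = 52.
upper-expansion : ∀ K r n → 12 + r ≡ n →
                  2 * ((52 * suc K + suc n) * (52 * suc K + suc n)) + slack K r
                  ≡ 676 * (8 * (K * suc K) + K * n) + 2704 * (suc n * suc n)
upper-expansion K r n eq = subst (λ n → 2 * ((52 * suc K + suc n) * (52 * suc K + suc n)) + slack K r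
                                      ≡ 676 * (8 * (K * suc K) + K * n) + 2704 * (suc n * suc n)) eq (expand K r)
  where
  expand : ∀ K r → 2 * ((52 * suc K + suc (12 + r)) * (52 * suc K + suc (12 + r)))
                   + (468 * (K * r) + (2702 * (r * r) + 70044 * r + 448526))
                 ≡ 676 * (8 * (K * suc K) + K * (12 + r)) + 2704 * (suc (12 + r) * suc (12 + r))
  expand = solve-∀

upper-bound : ∀ {n k} → 13 ≤ n → HasAchromaticArbColoring n k → 2 * (52 * k + n) ^ 2 ≤ 52 ^ 2 * n ^ 3
upper-bound {suc n} {zero} _ (col , _) with col zero zero
... | ()
upper-bound {suc n} {suc K} (s≤s 12≤n) has = let (r , eq) = m≤n⇒∃[o]m+o≡n 12≤n in
  upper-arithmetic (52 * suc K + suc n) (suc n) K n (slack K r) (upper-expansion K r n eq) refl (quadratic-bound has)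

-- The lower bound

size : ℕ → ℕ
size v = v * suc v + triangle v

size-< : ∀ v → size v < size (suc v)
size-< v = +-mono-<-≤ (*-mono-< (n<1+n v) (n<1+n (suc v))) (m≤m+n (triangle v) v)

size-search : ∀ n → ∃ λ v → size v ≤ n × n < size (suc v)
size-search zero    = 0 , z≤n , s≤s z≤n
size-search (suc n) with size-search n
... | v , lo , hi with suc n <? size (suc v)
... | yes lt = v , m≤n⇒m≤1+n lo , lt
... | no ≮   = suc v , ≮⇒≥ ≮ , ≤-<-trans hi (size-< (suc v))

2triangle : ∀ v → 2 * triangle v + v ≡ v * v
2triangle zero    = refl
2triangle (suc v) = begin
  2 * (triangle v + v) + suc v         ≡⟨ e₁ (triangle v) v ⟩
  (2 * triangle v + v) + (2 * v + 1)   ≡⟨ cong (_+ (2 * v + 1)) (2triangle v) ⟩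
  v * v + (2 * v + 1)                  ≡⟨ e₂ v ⟩
  suc v * suc v                        ∎
  where
  open ≡-Reasoning
  e₁ : ∀ t v → 2 * (t + v) + suc v ≡ (2 * t + v) + (2 * v + 1)
  e₁ = solve-∀
  e₂ : ∀ v → v * v + (2 * v + 1) ≡ suc v * suc v
  e₂ = solve-∀

2size : ∀ v → 2 * size v ≡ 3 * (v * v) + v
2size v = begin
  2 * (v * suc v + triangle v)                      ≡⟨ e₁ v (triangle v) ⟩
  2 * (v * v) + v + (2 * triangle v + v)            ≡⟨ cong (2 * (v * v) + v +_) (2triangle v) ⟩
  2 * (v * v) + v + v * v                           ≡⟨ e₂ v ⟩
  3 * (v * v) + v                                   ∎
  where
  open ≡-Reasoning
  e₁ : ∀ v t → 2 * (v * suc v + t) ≡ 2 * (v * v) + v + (2 * t + v)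
  e₁ = solve-∀
  e₂ : ∀ v → 2 * (v * v) + v + v * v ≡ 3 * (v * v) + v
  e₂ = solve-∀

-- `upperPoly v` is 2 `size (suc v)` - 2, the largest value of 2`n` for the given `v`; `lowerPoly v`
-- bounds 2(`A` + 5`n`) from below.
upperPoly lowerPoly : ℕ → ℕ
upperPoly v = 3 * (v * v) + 7 * v + 2
lowerPoly v = v * (v * v) + 4 * (3 * (v * v) + v)

-- The leading coefficients are 27 and 32. The difference is written out with nonnegative
-- coefficients; its last terms 92`v`² - 84`v` - 8 are negative at `v` = 0 and are therefore
-- expanded in `u` = `v` - 1.
upperPoly³≤32lowerPoly² : ∀ u → upperPoly (suc u) * (upperPoly (suc u) * upperPoly (suc u)) ≤ 32 * (lowerPoly (suc u) * lowerPoly (suc u))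
upperPoly³≤32lowerPoly² u = subst (upperPoly (suc u) * (upperPoly (suc u) * upperPoly (suc u)) ≤_) (expand u) (m≤m+n _ _)
  where
  expand : ∀ u → let v = suc u
                     p = 3 * (v * v) + 7 * v + 2
                     m = v * (v * v) + 4 * (3 * (v * v) + v) in
           p * (p * p) + (v * v * (5 * (v * v * v * v) + 579 * (v * v * v) + 4369 * (v * v) + 2477 * v + 90) + (92 * (u * u) + 100 * u))
           ≡ 32 * (m * m)
  expand = solve-∀

module _ {v n A : ℕ} (lo : size v ≤ n) (hi : n < size (suc v)) (Tv≤A : triangle v * v ≤ A) where
  open ≤-Reasoning

  2n≤upperPoly : 2 * n ≤ upperPoly v
  2n≤upperPoly = +-cancelʳ-≤ 2 (2 * n) (upperPoly v) (begin
    2 * n + 2                           ≡⟨ e₁ n ⟩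
    2 * suc n                           ≤⟨ *-monoʳ-≤ 2 hi ⟩
    2 * size (suc v)                    ≡⟨ 2size (suc v) ⟩
    3 * (suc v * suc v) + suc v         ≡⟨ e₂ v ⟩
    upperPoly v + 2                             ∎)
    where
    e₁ : ∀ n → 2 * n + 2 ≡ 2 * suc n
    e₁ = solve-∀
    e₂ : ∀ v → 3 * (suc v * suc v) + suc v ≡ 3 * (v * v) + 7 * v + 2 + 2
    e₂ = solve-∀

  3v²+v≤2n : 3 * (v * v) + v ≤ 2 * n
  3v²+v≤2n = subst (_≤ 2 * n) (2size v) (*-monoʳ-≤ 2 lo)

  -- Twice the number of double stars is `v`³ - `v`². Of the 5`n`, one `n` makes up for the missing
  -- `v`² and the other four supply the quadratic surplus of `lowerPoly`.
  lowerPoly≤ : lowerPoly v ≤ 2 * (A + 5 * n)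
  lowerPoly≤ = begin
    v * (v * v) + 4 * (3 * (v * v) + v)                     ≡⟨ cong (λ z → v * z + 4 * (3 * (v * v) + v)) (sym (2triangle v)) ⟩
    v * (2 * triangle v + v) + 4 * (3 * (v * v) + v)        ≡⟨ e₁ v (triangle v) (3 * (v * v) + v) ⟩
    2 * (triangle v * v) + v * v + 4 * (3 * (v * v) + v)    ≤⟨ +-mono-≤ (+-mono-≤ (*-monoʳ-≤ 2 Tv≤A) v²≤2n) (*-monoʳ-≤ 4 3v²+v≤2n) ⟩
    2 * A + 2 * n + 4 * (2 * n)                             ≡⟨ e₂ A n ⟩
    2 * (A + 5 * n)                                         ∎
    where
    v²≤2n : v * v ≤ 2 * n
    v²≤2n = ≤-trans (≤-trans (m≤m+n (v * v) _) (m≤m+n (3 * (v * v)) v)) 3v²+v≤2n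
    e₁ : ∀ v t x → v * (2 * t + v) + 4 * x ≡ 2 * (t * v) + v * v + 4 * x
    e₁ = solve-∀
    e₂ : ∀ A n → 2 * A + 2 * n + 4 * (2 * n) ≡ 2 * (A + 5 * n)
    e₂ = solve-∀

lower-arithmetic : ∀ p m n B → 2 * n ≤ p → p * (p * p) ≤ 32 * (m * m) → m ≤ 2 * B → n ^ 3 ≤ 16 * B ^ 2
lower-arithmetic p m n B 2n≤p p³≤ m≤ = *-cancelˡ-≤ 8 (begin
  8 * (n * (n * (n * 1)))       ≡⟨ e₁ n ⟩
  2 * n * (2 * n * (2 * n))     ≤⟨ *-mono-≤ 2n≤p (*-mono-≤ 2n≤p 2n≤p) ⟩
  p * (p * p)                   ≤⟨ p³≤ ⟩
  32 * (m * m)                  ≤⟨ *-monoʳ-≤ 32 (*-mono-≤ m≤ m≤) ⟩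
  32 * (2 * B * (2 * B))        ≡⟨ e₂ B ⟩
  8 * (16 * (B * (B * 1)))      ∎)
  where
  open ≤-Reasoning
  e₁ : ∀ n → 8 * (n * (n * (n * 1))) ≡ 2 * n * (2 * n * (2 * n))
  e₁ = solve-∀
  e₂ : ∀ B → 32 * (2 * B * (2 * B)) ≡ 8 * (16 * (B * (B * 1)))
  e₂ = solve-∀

lower-bound : ∀ {n A} v → size v ≤ n → n < size (suc v) → 13 ≤ n → triangle v * v ≤ A → n ^ 3 ≤ 16 * (A + 5 * n) ^ 2
-- `size 1` is 2, so `v` = 0 would force `n` < 2.
lower-bound zero    lo hi 13≤n _ = ⊥-elim (<-irrefl refl (<-≤-trans hi (≤-trans (s≤s (s≤s z≤n)) 13≤n)))
lower-bound {n} {A} (suc u) lo hi _ Tv≤A =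
  lower-arithmetic (upperPoly (suc u)) (lowerPoly (suc u)) n (A + 5 * n) (2n≤upperPoly {suc u} {A = A} lo hi Tv≤A) (upperPoly³≤32lowerPoly² u) (lowerPoly≤ {suc u} lo hi Tv≤A)

-- Squaring removes the radicals: the inequalities say `n`^{3/2}/4 - `C` `n` ≤ `A` and `A` ≤
-- `n`^{3/2}/√2 - `n`/`d`.
theorem4 : Σ ℕ λ C → Σ ℕ λ d → (0 < d) ×
    ((n : ℕ) → 13 ≤ n → Σ ℕ λ A →
    IsAchromaticArboricityK n A
    × (n ^ 3 ≤ 16 * (A + C * n) ^ 2)
    × (2 * (d * A + n) ^ 2 ≤ d ^ 2 * n ^ 3))
theorem4 = 5 , 52 , s≤s z≤n , λ n 13≤n →
  let (v , lo , hi)       = size-search n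
      (k , Tv≤k , has)    = grid-coloring v lo (≤-trans (s≤s (s≤s z≤n)) 13≤n)
      (A , hasA , maxA)   = achromaticArboricityK (k , has)
  in A , (hasA , maxA) , lower-bound v lo hi 13≤n (≤-trans Tv≤k (maxA k has)) , upper-bound 13≤n hasA
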